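{- For any integer $k \geq 2$, every $\left( \left\lceil \frac{\delta(G)^2}{\delta(G)-k} \right\rceil - 2 \right)$-connected line graph $L(G)$ has $k$ completely independent spanning trees if $G$ is super edge-connected and $k < \delta(G) < 2k$.
   Context: All graphs are finite, simple and undirected. $L(G)$ is the line graph of $G$ (vertex set $E(G)$, two vertices adjacent iff the corresponding edges share an endpoint). $\delta(G)$ is the minimum degree of $G$. A graph is $m$-connected if its (vertex) connectivity is at least $m$. An edge-cut of a connected graph is a set of edges whose removal disconnects it; a connected graph is super edge-connected if every minimum edge-cut isolates a vertex. Spanning trees $T_1,\dots,T_k$ of a graph $H$ are completely independent if for any two distinct vertices $u,v$ of $H$, the $u$–$v$ paths in $T_1,\dots,T_k$ are pairwise edge-disjoint and pairwise share no vertex other than $u$ and $v$. -}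

module Defs where

open import Data.Nat using (ℕ; zero; suc; _+_; _*_; _∸_; _≤_; _<_)
open import Data.Nat.DivMod using (_/_)
open import Data.Bool using (Bool; true; false)
open import Data.Fin using (Fin)
import Data.Fin as F
open import Data.List using (List; []; _∷_; length; filterᵇ; allFin)
open import Data.List.Relation.Unary.Unique.Propositional using (Unique)
open import Data.List.Membership.Propositional using (_∈_; _∉_)
open import Data.Product using (Σ; ∃; _×_; _,_; proj₁; proj₂)
open import Data.Sum using (_⊎_)
open import Data.Empty using (⊥)
open import Relation.Nullary using (¬_)
open import Relation.Binary.PropositionalEquality using (_≡_; _≢_)

data Walk {V : Set} (E : V → V → Set) : V → V → Set where
  here : ∀ {u} → Walk E u u
  step : ∀ {u x v} → E u x → Walk E x v → Walk E u v

module _ {V : Set} {E : V → V → Set} where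

  verts : ∀ {u v} → Walk E u v → List V
  verts {u} here = u ∷ []
  verts {u} (step _ w) = u ∷ verts w

  edges : ∀ {u v} → Walk E u v → List (V × V)
  edges here = []
  edges {u} (step {x = x} _ w) = (u , x) ∷ edges w

  len : ∀ {u v} → Walk E u v → ℕ
  len here = 0
  len (step _ w) = suc (len w)

Path : {V : Set} → (V → V → Set) → V → V → Set
Path E u v = Σ (Walk E u v) λ w → Unique (verts w)

Connected : {V : Set} → (V → V → Set) → Set
Connected {V} E = (u v : V) → Walk E u v

Cycle : {V : Set} → (V → V → Set) → Set
Cycle {V} E = Σ V λ a → Σ V λ b → Σ (Path E a b) λ p → (2 ≤ len (proj₁ p)) × E b a

Acyclic : {V : Set} → (V → V → Set) → Set
Acyclic E = ¬ Cycle E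

IsSpanningTree : {V : Set} → (V → V → Set) → (V → V → Set) → Set
IsSpanningTree {V} E T =
  ((u v : V) → T u v → E u v) × ((u v : V) → T u v → T v u)
  × Connected T × Acyclic T

CompletelyIndependent : {V : Set} → (k : ℕ) → (Fin k → V → V → Set) → Set
CompletelyIndependent {V} k T =
  (i j : Fin k) → i ≢ j → (u v : V) → u ≢ v →
  (P : Path (T i) u v) → (Q : Path (T j) u v) →
    ((a b : V) → (a , b) ∈ edges (proj₁ P) →
       ((a , b) ∉ edges (proj₁ Q)) × ((b , a) ∉ edges (proj₁ Q)))
  × ((x : V) → x ∈ verts (proj₁ P) → x ∈ verts (proj₁ Q) → (x ≡ u) ⊎ (x ≡ v))

HasCISTs : {V : Set} → (V → V → Set) → ℕ → Set₁
HasCISTs {V} E k =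
  Σ (Fin k → V → V → Set) λ T →
    ((i : Fin k) → IsSpanningTree E (T i)) × CompletelyIndependent k T

MConnected : {V : Set} → (V → V → Set) → ℕ → Set
MConnected {V} E m =
  (Σ (List V) λ xs → Unique xs × m < length xs)
  × ((S : List V) → length S < m → (a b : V) → a ∉ S → b ∉ S →
       Σ (Walk E a b) λ w → (x : V) → x ∈ verts w → x ∉ S)

record Graph (n : ℕ) : Set where
  field
    adj    : Fin n → Fin n → Bool
    sym    : ∀ u v → adj u v ≡ adj v u
    irrefl : ∀ v → adj v v ≡ false
open Graph public

Adj : ∀ {n} → Graph n → Fin n → Fin n → Set
Adj G u v = adj G u v ≡ true

degree : ∀ {n} → Graph n → Fin n → ℕ
degree {n} G v = length (filterᵇ (adj G v) (allFin n))

MinDegree : ∀ {n} → Graph n → ℕ → Set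
MinDegree {n} G d = ((v : Fin n) → d ≤ degree G v) × Σ (Fin n) λ v → degree G v ≡ d

Edge : ∀ {n} → Graph n → Set
Edge {n} G = Σ (Fin n × Fin n) λ p → (proj₁ p F.< proj₂ p) × Adj G (proj₁ p) (proj₂ p)

LineAdj : ∀ {n} (G : Graph n) → Edge G → Edge G → Set
LineAdj G ((a , b) , _) ((c , d) , _) =
  ((a , b) ≢ (c , d)) × ((a ≡ c) ⊎ (a ≡ d) ⊎ (b ≡ c) ⊎ (b ≡ d))

-- G − F for a set F of edges (given as a list of pairs (u , v), u < v)
RemoveEdges : ∀ {n} (G : Graph n) → List (Fin n × Fin n) → Fin n → Fin n → Set
RemoveEdges G F u v = Adj G u v × ((u , v) ∉ F) × ((v , u) ∉ F)

IsEdgeCut : ∀ {n} (G : Graph n) → List (Fin n × Fin n) → Set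
IsEdgeCut {n} G F =
  Unique F × ((e : Fin n × Fin n) → e ∈ F → (proj₁ e F.< proj₂ e) × Adj G (proj₁ e) (proj₂ e))
  × ¬ Connected (RemoveEdges G F)

IsMinEdgeCut : ∀ {n} (G : Graph n) → List (Fin n × Fin n) → Set
IsMinEdgeCut G F = IsEdgeCut G F × ((F' : List _) → IsEdgeCut G F' → length F ≤ length F')

SuperEdgeConnected : ∀ {n} → Graph n → Set
SuperEdgeConnected {n} G =
  Connected (Adj G) ×
  ((F : List (Fin n × Fin n)) → IsMinEdgeCut G F →
     Σ (Fin n) λ v → (w : Fin n) → ¬ RemoveEdges G F v w)

-- ceiling division ⌈a / b⌉ (b > 0; value 0 for b = 0, never used)
ceilDiv : ℕ → ℕ → ℕ
ceilDiv a zero = 0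
ceilDiv a (suc t) = (a + t) / suc t

{-# OPTIONS --safe #-}
-- Write c = d − k. Connectivity of L(G) bounds deg u + deg v from below by d²/c for every edge uv,
-- and it bounds the boundary of a vertex set X from below by d²/c − 2 when both X and its complement
-- contain an edge. Distributing the crossing edges of a partition of V(G) over its p blocks, with
-- shares decreasing in the size of the boundary, gives at least k p crossing edges, except when all
-- but one of the blocks together form an independent set; then there are at least d (p − 1). Hence
-- G has k edge-disjoint spanning trees (Nash-Williams and Tutte, here as Edmonds' theorem for the
-- cycle matroid), and |E(G)| ≥ k n leaves one further edge for each of them. So E(G) splits into k
-- classes, each spanning, connected and not a tree, and in each class the vertices can choose
-- distinct incident edges. These choices attach the edges of the other classes to a spanning tree
-- of the line graph of the class as leaves, without using any adjacency of L(G) in two trees.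
module Submission where

open import Defs renaming (sym to adj-sym)
open import Data.Bool using (true)
import Data.Bool as B
open import Data.Bool.Properties using (T-≡)
open import Data.Empty using (⊥)
open import Data.Fin using (Fin; _≟_; inject≤)
import Data.Fin as F
import Data.Fin.Properties as F
open import Data.List using (List; []; _∷_; _++_; length; filter; map; lookup; allFin; cartesianProduct)
open import Data.List.Properties using (length-filter; length-tabulate)
open import Data.List.Membership.Propositional using (_∈_; _∉_; find; lose)
open import Data.List.Membership.Propositional.Properties using (∈-allFin; ∈-cartesianProduct⁺; ∈-filter⁺; ∈-filter⁻; ∈-lookup; ∈-++⁺ˡ; ∈-++⁺ʳ; ∈-++⁻)
open import Data.List.Relation.Binary.Permutation.Propositional using (_↭_; prep; swap; ↭-sym)
open import Data.List.Relation.Binary.Permutation.Propositional.Properties using (∈-resp-↭; ++-comm)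
import Data.List.Relation.Unary.All as All
open import Data.List.Relation.Unary.All using ([]; _∷_)
open import Data.List.Relation.Unary.AllPairs using ([]; _∷_)
open import Data.List.Relation.Unary.Any using (here; there; any?)
open import Data.List.Relation.Unary.Unique.Propositional using (Unique)
import Data.List.Relation.Unary.Unique.Propositional.Properties as Unique
open import Data.Nat using (ℕ; zero; suc; _+_; _*_; _∸_; _⊔_; _/_; _%_; _≤_; _<_; z≤n; s≤s; >-nonZero)
open import Data.Nat.DivMod using (m≡m%n+[m/n]*n; m%n<n)
open import Data.Nat.Induction using (<-wellFounded)
open import Data.Nat.Properties hiding (_≟_; _<?_; <-cmp)
open import Data.Nat.Tactic.RingSolver using (solve-∀)
open import Data.Product using (Σ; ∃; _×_; _,_; proj₁; proj₂)
open import Data.Product.Properties using (≡-dec)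
open import Data.Sum using (_⊎_; inj₁; inj₂; [_,_]′)
import Data.Sum as Sum
open import Algebra.Properties.CommutativeSemigroup +-commutativeSemigroup using (interchange)
open import Function using (_∘_; id; Equivalence)
open import Induction.WellFounded using (Acc; acc)
open import Relation.Binary.Definitions using (DecidableEquality; tri<; tri≈; tri>)
open import Relation.Binary.PropositionalEquality using (_≡_; _≢_; refl; sym; trans; cong; cong₂; subst; subst₂; module ≡-Reasoning)
open import Relation.Nullary using (¬_; Dec; yes; no; contradiction; ¬?)
open import Relation.Nullary.Decidable using (_×-dec_; _⊎-dec_; decidable-stable; map′)
open import Relation.Unary using (Decidable)

-- Sums of natural numbers over lists

-- The constant d²/c comes from the shares. A block with b boundary edges must collect k in all, so
-- its natural share of each is k/b, and no edge may give more than 1. Two blocks joined by an edge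
-- have b, b' ≥ d and b + b' ≥ d²/c. Since k/b is convex and decreasing, the worst pair is b = d, b'
-- = d²/c - d = dk/c, where the shares k/d and c/d add up to exactly 1. Replacing k/b by its chord
-- between these two points loses nothing at the worst pair, and scaling by d² keeps the computation
-- in the natural numbers. An edge uv has deg u + deg v - 2 neighbours in L(G), which accounts for
-- the 2 in the connectivity. A boundary used as a separator only yields m; the missing 2 is
-- supplied by the block on the other side, whose boundary has at least d ≥ 2 edges. The separator
-- argument needs an edge on either side, hence the exceptional partitions. A spanning tree has n -
-- 1 edges, one too few for n vertices to choose distinct incident edges. This is why each class
-- must be larger than a tree.

𝟙 : {P : Set} → Dec P → ℕ
𝟙 (yes _) = 1
𝟙 (no _)  = 0

𝟙-yes : {P : Set} (P? : Dec P) → P → 𝟙 P? ≡ 1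
𝟙-yes (yes _) _ = refl
𝟙-yes (no ¬p) p = contradiction p ¬p

𝟙-no : {P : Set} (P? : Dec P) → ¬ P → 𝟙 P? ≡ 0
𝟙-no (yes p) ¬p = contradiction p ¬p
𝟙-no (no _)  _  = refl

𝟙-mono : {P Q : Set} (P? : Dec P) (Q? : Dec Q) → (P → Q) → 𝟙 P? ≤ 𝟙 Q?
𝟙-mono (yes p) Q? f = ≤-reflexive (sym (𝟙-yes Q? (f p)))
𝟙-mono (no _)  Q? f = z≤n

𝟙-cong : {P Q : Set} (P? : Dec P) (Q? : Dec Q) → (P → Q) → (Q → P) → 𝟙 P? ≡ 𝟙 Q?
𝟙-cong P? Q? f g = ≤-antisym (𝟙-mono P? Q? f) (𝟙-mono Q? P? g)

module _ {A : Set} where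

  ∑ : List A → (A → ℕ) → ℕ
  ∑ []       f = 0
  ∑ (x ∷ xs) f = f x + ∑ xs f

  ∑-cong : ∀ xs {f g : A → ℕ} → (∀ x → f x ≡ g x) → ∑ xs f ≡ ∑ xs g
  ∑-cong []       eq = refl
  ∑-cong (x ∷ xs) eq = cong₂ _+_ (eq x) (∑-cong xs eq)

  ∑-mono : ∀ xs {f g : A → ℕ} → (∀ x → f x ≤ g x) → ∑ xs f ≤ ∑ xs g
  ∑-mono []       le = z≤n
  ∑-mono (x ∷ xs) le = +-mono-≤ (le x) (∑-mono xs le)

  ∑-mono-< : ∀ xs {f g : A → ℕ} → (∀ x → f x ≤ g x) → ∀ {y} → y ∈ xs → f y < g y → ∑ xs f < ∑ xs g
  ∑-mono-< (x ∷ xs) le (here refl) lt = +-mono-<-≤ lt (∑-mono xs le)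
  ∑-mono-< (x ∷ xs) le (there y∈)  lt = +-mono-≤-< (le x) (∑-mono-< xs le y∈ lt)

  ∑-+ : ∀ xs (f g : A → ℕ) → ∑ xs (λ x → f x + g x) ≡ ∑ xs f + ∑ xs g
  ∑-+ []       f g = refl
  ∑-+ (x ∷ xs) f g = trans (cong (f x + g x +_) (∑-+ xs f g)) (interchange (f x) (g x) _ _)

  ∑-*ˡ : ∀ xs c (f : A → ℕ) → ∑ xs (λ x → c * f x) ≡ c * ∑ xs f
  ∑-*ˡ []       c f = sym (*-zeroʳ c)
  ∑-*ˡ (x ∷ xs) c f = trans (cong (c * f x +_) (∑-*ˡ xs c f)) (sym (*-distribˡ-+ c (f x) _))

  ∑-*ʳ : ∀ xs c (f : A → ℕ) → ∑ xs (λ x → f x * c) ≡ ∑ xs f * c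
  ∑-*ʳ []       c f = refl
  ∑-*ʳ (x ∷ xs) c f = trans (cong (f x * c +_) (∑-*ʳ xs c f)) (sym (*-distribʳ-+ c (f x) _))

  ∑-const : ∀ xs c → ∑ xs (λ (_ : A) → c) ≡ length xs * c
  ∑-const []       c = refl
  ∑-const (x ∷ xs) c = cong (c +_) (∑-const xs c)

  ∑-zero : ∀ xs → ∑ xs (λ (_ : A) → 0) ≡ 0
  ∑-zero []       = refl
  ∑-zero (_ ∷ xs) = ∑-zero xs

  ∑-++ : ∀ xs ys (f : A → ℕ) → ∑ (xs ++ ys) f ≡ ∑ xs f + ∑ ys f
  ∑-++ []       ys f = refl
  ∑-++ (x ∷ xs) ys f = trans (cong (f x +_) (∑-++ xs ys f)) (sym (+-assoc (f x) _ _))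

  ∑-member : ∀ {xs x} (f : A → ℕ) → x ∈ xs → f x ≤ ∑ xs f
  ∑-member f (here refl) = m≤m+n _ _
  ∑-member f (there x∈)  = ≤-trans (∑-member f x∈) (m≤n+m _ _)

  ∑-vanish : ∀ xs (f : A → ℕ) → (∀ {x} → x ∈ xs → f x ≡ 0) → ∑ xs f ≡ 0
  ∑-vanish []       f eq = refl
  ∑-vanish (x ∷ xs) f eq = cong₂ _+_ (eq (here refl)) (∑-vanish xs f (eq ∘ there))

  ∑-single : ∀ {xs y} (f : A → ℕ) → Unique xs → y ∈ xs → (∀ x → x ≢ y → f x ≡ 0) → ∑ xs f ≡ f y
  ∑-single f (y∉ ∷ u) (here refl) eq =
    trans (cong (f _ +_) (∑-vanish _ f λ x∈ → eq _ λ x≡y → All.lookup y∉ x∈ (sym x≡y))) (+-identityʳ _)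
  ∑-single f (x∉ ∷ u) (there y∈)  eq =
    cong₂ _+_ (eq _ (All.lookup x∉ y∈)) (∑-single f u y∈ eq)

  length-filter-∑ : ∀ {P : A → Set} (P? : ∀ x → Dec (P x)) xs → length (filter P? xs) ≡ ∑ xs (𝟙 ∘ P?)
  length-filter-∑ P? []       = refl
  length-filter-∑ P? (x ∷ xs) with P? x
  ... | yes _ = cong suc (length-filter-∑ P? xs)
  ... | no _  = length-filter-∑ P? xs

∑-swap : {A B : Set} (xs : List A) (ys : List B) (f : A → B → ℕ) →
  ∑ xs (λ x → ∑ ys (f x)) ≡ ∑ ys (λ y → ∑ xs (λ x → f x y))
∑-swap []       ys f = sym (∑-zero ys)
∑-swap (x ∷ xs) ys f = trans (cong (∑ ys (f x) +_) (∑-swap xs ys f)) (sym (∑-+ ys (f x) _))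

∑-allFin-const : ∀ n c → ∑ (allFin n) (λ _ → c) ≡ n * c
∑-allFin-const n c = trans (∑-const (allFin n) c) (cong (_* c) (length-tabulate {n = n} id))

-- Packing bases of a matroid

module Matroid {E : Set}
  (_∈cl_ : E → List E → Set)
  (_∈cl?_ : ∀ e A → Dec (e ∈cl A))
  (cl-extensive : ∀ {e A} → e ∈ A → e ∈cl A)
  (cl-closed : ∀ {A B e} → (∀ {a} → a ∈ A → a ∈cl B) → e ∈cl A → e ∈cl B)
  (cl-exchange : ∀ {e f A} → f ∈cl (e ∷ A) → ¬ (f ∈cl A) → e ∈cl (f ∷ A))
  where

  cl-mono : ∀ {A B e} → (∀ {a} → a ∈ A → a ∈ B) → e ∈cl A → e ∈cl B
  cl-mono A⊆B = cl-closed (cl-extensive ∘ A⊆B)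

  cl-absorb : ∀ {e f A} → e ∈cl A → f ∈cl (e ∷ A) → f ∈cl A
  cl-absorb e∈ = cl-closed λ { (here refl) → e∈ ; (there a∈) → cl-extensive a∈ }

  -- Greedy count from the end of the list. That only the set of elements matters, and not their
  -- order, is `rank-↭` together with `rank-mono`.
  rank : List E → ℕ
  rank []      = 0
  rank (e ∷ A) = 𝟙 (¬? (e ∈cl? A)) + rank A

  private
    new : E → List E → ℕ
    new e A = 𝟙 (¬? (e ∈cl? A))

    new-cong : ∀ {A B} e → (∀ {a} → a ∈ A → a ∈ B) → (∀ {b} → b ∈ B → b ∈ A) → new e A ≡ new e B
    new-cong e A⊆B B⊆A = 𝟙-cong (¬? (e ∈cl? _)) (¬? (e ∈cl? _)) (_∘ cl-mono B⊆A) (_∘ cl-mono A⊆B)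

    -- The exchange axiom in counting form: two elements add the same amount to the rank in either
    -- order. The impossible rows of the case table are refuted by monotonicity, absorption or
    -- exchange.
    new-swap : ∀ e f A → new e (f ∷ A) + new f A ≡ new f (e ∷ A) + new e A
    new-swap e f A with e ∈cl? A | f ∈cl? A | e ∈cl? (f ∷ A) | f ∈cl? (e ∷ A)
    ... | yes _ | yes _ | yes _ | yes _ = refl
    ... | yes p | _     | no q  | _     = contradiction (cl-mono there p) q
    ... | _     | yes p | _     | no q  = contradiction (cl-mono there p) q
    ... | yes p | no q  | yes _ | yes r = contradiction (cl-absorb p r) q
    ... | yes _ | no _  | yes _ | no _  = refl
    ... | no q  | yes p | yes r | yes _ = contradiction (cl-absorb p r) q
    ... | no _  | yes _ | no _  | yes _ = refl
    ... | no _  | no _  | yes _ | yes _ = refl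
    ... | no p  | no _  | yes q | no r  = contradiction (cl-exchange q p) r
    ... | no _  | no p  | no r  | yes q = contradiction (cl-exchange q p) r
    ... | no _  | no _  | no _  | no _  = refl

  rank-↭ : ∀ {A B} → A ↭ B → rank A ≡ rank B
  rank-↭ _↭_.refl = refl
  rank-↭ (prep x p) = cong₂ _+_ (new-cong x (∈-resp-↭ p) (∈-resp-↭ (↭-sym p))) (rank-↭ p)
  rank-↭ (swap {xs} {ys} x y p) = begin
    new x (y ∷ xs) + (new y xs + rank xs)  ≡⟨ +-assoc (new x (y ∷ xs)) _ _ ⟨
    new x (y ∷ xs) + new y xs + rank xs    ≡⟨ cong (_+ rank xs) (new-swap x y xs) ⟩
    new y (x ∷ xs) + new x xs + rank xs    ≡⟨ +-assoc (new y (x ∷ xs)) _ _ ⟩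
    rank (y ∷ x ∷ xs)                      ≡⟨ cong₂ _+_ (new-cong y (∈-resp-↭ (prep x p)) (∈-resp-↭ (↭-sym (prep x p))))
                                                      (cong₂ _+_ (new-cong x (∈-resp-↭ p) (∈-resp-↭ (↭-sym p))) (rank-↭ p)) ⟩
    rank (y ∷ x ∷ ys)                      ∎
    where open ≡-Reasoning
  rank-↭ (_↭_.trans p q) = trans (rank-↭ p) (rank-↭ q)

  rank-∷-spanned : ∀ {e A} → e ∈cl A → rank (e ∷ A) ≡ rank A
  rank-∷-spanned {e} {A} e∈ = cong (_+ rank A) (𝟙-no (¬? (e ∈cl? A)) (λ e∉ → e∉ e∈))

  rank-∷-new : ∀ {e A} → ¬ e ∈cl A → rank (e ∷ A) ≡ suc (rank A)
  rank-∷-new {e} {A} e∉ = cong (_+ rank A) (𝟙-yes (¬? (e ∈cl? A)) e∉)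

  rank-++-spanned : ∀ A {B} → (∀ {a} → a ∈ A → a ∈cl B) → rank (A ++ B) ≡ rank B
  rank-++-spanned []      A⊆ = refl
  rank-++-spanned (a ∷ A) A⊆ =
    trans (rank-∷-spanned (cl-mono (∈-++⁺ʳ A) (A⊆ (here refl)))) (rank-++-spanned A (A⊆ ∘ there))

  rank-++-≥ : ∀ A {B} → rank B ≤ rank (A ++ B)
  rank-++-≥ []      = ≤-refl
  rank-++-≥ (a ∷ A) = ≤-trans (rank-++-≥ A) (m≤n+m _ _)

  rank-mono : ∀ {A B} → (∀ {a} → a ∈ A → a ∈cl B) → rank A ≤ rank B
  rank-mono {A} {B} A⊆ = begin
    rank A         ≤⟨ rank-++-≥ B ⟩
    rank (B ++ A)  ≡⟨ rank-↭ (++-comm B A) ⟩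
    rank (A ++ B)  ≡⟨ rank-++-spanned A A⊆ ⟩
    rank B         ∎
    where open ≤-Reasoning

  basis : List E → List E
  basis []      = []
  basis (e ∷ A) with e ∈cl? A
  ... | yes _ = basis A
  ... | no _  = e ∷ basis A

  basis⊆ : ∀ A {e} → e ∈ basis A → e ∈ A
  basis⊆ (a ∷ A) e∈ with a ∈cl? A
  basis⊆ (a ∷ A) e∈          | yes _ = there (basis⊆ A e∈)
  basis⊆ (a ∷ A) (here refl) | no _  = here refl
  basis⊆ (a ∷ A) (there e∈)  | no _  = there (basis⊆ A e∈)

  basis-unique : ∀ {A} → Unique A → Unique (basis A)
  basis-unique [] = []
  basis-unique {a ∷ A} (a∉ ∷ u) with a ∈cl? A
  ... | yes _ = basis-unique u
  ... | no _  = All.tabulate (All.lookup a∉ ∘ basis⊆ A) ∷ basis-unique u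

  length-basis : ∀ A → length (basis A) ≡ rank A
  length-basis []      = refl
  length-basis (a ∷ A) with a ∈cl? A
  ... | yes _ = length-basis A
  ... | no _  = cong suc (length-basis A)

  basis-spans : ∀ A {e} → e ∈ A → e ∈cl basis A
  basis-spans (a ∷ A) e∈ with a ∈cl? A
  basis-spans (a ∷ A) (here refl) | yes a∈ = cl-closed (basis-spans A) a∈
  basis-spans (a ∷ A) (there e∈)  | yes _  = basis-spans A e∈
  basis-spans (a ∷ A) (here refl) | no _   = cl-extensive (here refl)
  basis-spans (a ∷ A) (there e∈)  | no _   = cl-mono there (basis-spans A e∈)

  module Colouring (_≟_ : DecidableEquality E) (ground : List E) (unique : Unique ground)
    (complete : ∀ e → e ∈ ground) {k : ℕ} where

    open import Data.List.Membership.DecPropositional _≟_ using (_∈?_)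

    class : (E → Fin k) → Fin k → List E
    class χ i = filter (λ e → χ e F.≟ i) ground

    ∈-class⁺ : ∀ {χ i e} → χ e ≡ i → e ∈ class χ i
    ∈-class⁺ = ∈-filter⁺ _ (complete _)

    ∈-class⁻ : ∀ {χ i e} → e ∈ class χ i → χ e ≡ i
    ∈-class⁻ {χ} {i} e∈ = proj₂ (∈-filter⁻ (λ e → χ e F.≟ i) {xs = ground} e∈)

    infixl 6 _∖_
    _∖_ : List E → E → List E
    A ∖ e = filter (λ a → ¬? (a ≟ e)) A

    ∈-∖⁺ : ∀ {A e a} → a ∈ A → a ≢ e → a ∈ A ∖ e
    ∈-∖⁺ = ∈-filter⁺ _

    ∈-∖⁻ : ∀ {A e a} → a ∈ A ∖ e → a ∈ A × a ≢ e
    ∈-∖⁻ {A} {e} = ∈-filter⁻ (λ a → ¬? (a ≟ e))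

    Redundant : (E → Fin k) → E → Set
    Redundant χ e = e ∈cl (class χ (χ e) ∖ e)

    recolour : (E → Fin k) → E → Fin k → E → Fin k
    recolour χ e i a with a ≟ e
    ... | yes _ = i
    ... | no _  = χ a

    recolour-same : ∀ χ e i → recolour χ e i e ≡ i
    recolour-same χ e i with e ≟ e
    ... | yes _  = refl
    ... | no e≢e = contradiction refl e≢e

    recolour-other : ∀ χ {e} i {a} → a ≢ e → recolour χ e i a ≡ χ a
    recolour-other χ {e} i {a} a≢e with a ≟ e
    ... | yes a≡e = contradiction a≡e a≢e
    ... | no _    = refl

    ∈-recolour⁻ : ∀ χ {e i j a} → a ∈ class (recolour χ e i) j → (a ≡ e × j ≡ i) ⊎ (a ∈ class χ j)
    ∈-recolour⁻ χ {e} {i} {j} {a} a∈ with a ≟ e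
    ... | yes refl = inj₁ (refl , trans (sym (∈-class⁻ a∈)) (recolour-same χ e i))
    ... | no a≢e   = inj₂ (∈-class⁺ (trans (sym (recolour-other χ i a≢e)) (∈-class⁻ a∈)))

    totalRank : (E → Fin k) → ℕ
    totalRank χ = ∑ (allFin k) (rank ∘ class χ)

    class-recolour : ∀ {χ e} i → Redundant χ e → ∀ j {a} → a ∈ class χ j → a ∈cl class (recolour χ e i) j
    class-recolour {χ} {e} i red j {a} a∈ with a ≟ e
    ... | no a≢e   = cl-extensive (∈-class⁺ (trans (recolour-other χ i a≢e) (∈-class⁻ a∈)))
    ... | yes refl = cl-mono
      (λ b∈ → let b∈class , b≢e = ∈-∖⁻ b∈ in
        ∈-class⁺ (trans (recolour-other χ i b≢e) (trans (∈-class⁻ b∈class) (∈-class⁻ a∈)))) red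

    -- An augmenting chain e = e₀, e₁, …, eₘ: each eₛ is separated from the class of eₛ₊₁ once
    -- eₛ₊₁ is removed from it, and eₘ is not spanned by some class.
    data Augmenting (χ : E → Fin k) (e : E) : ℕ → Set where
      exit : ∀ i → ¬ e ∈cl class χ i → Augmenting χ e 0
      hop  : ∀ {m} f → ¬ e ∈cl (class χ (χ f) ∖ f) → Augmenting χ f m → Augmenting χ e (suc m)

    -- Adding e to a class spoils a hop or an exit only if e could make that hop or exit itself.
    augmenting-recolour : ∀ {χ e} i {f m} → Augmenting χ f m →
      Augmenting (recolour χ e i) f m ⊎ (∃ λ m' → m' ≤ m × Augmenting χ e m')
    augmenting-recolour {χ} {e} i {f} (exit j f∉)
      with f ∈cl? class (recolour χ e i) j
    ... | no f∉'  = inj₁ (exit j f∉')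
    ... | yes f∈' with e ∈cl? class χ j
    ...   | no e∉  = inj₂ (0 , z≤n , exit j e∉)
    ...   | yes e∈ = contradiction
      (cl-closed (λ a∈ → [ (λ { (refl , _) → e∈ }) , cl-extensive ]′ (∈-recolour⁻ χ a∈)) f∈') f∉
    augmenting-recolour {χ} {e} i {f} (hop {m} g f∉ chain)
      with g ≟ e | augmenting-recolour {e = e} i chain
    -- The chain passes through `e` itself, and its tail is already a chain for `e`.
    ... | yes refl | _ = inj₂ (m , n≤1+n m , chain)
    ... | no _ | inj₂ (m' , m'≤m , chain') = inj₂ (m' , m≤n⇒m≤1+n m'≤m , chain')
    ... | no g≢e | inj₁ chain' with f ∈cl? (class (recolour χ e i) (recolour χ e i g) ∖ g)
    ...   | no f∉'  = inj₁ (hop g f∉' chain')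
    ...   | yes f∈' with e ∈cl? (class χ (χ g) ∖ g)
    ...     | no e∉  = inj₂ (suc m , ≤-refl , hop g e∉ chain)
    ...     | yes e∈ = contradiction (cl-closed spanned f∈') f∉
      where
      spanned : ∀ {a} → a ∈ class (recolour χ e i) (recolour χ e i g) ∖ g → a ∈cl (class χ (χ g) ∖ g)
      spanned a∈ with ∈-∖⁻ a∈
      ... | a∈class , a≢g with ∈-recolour⁻ χ a∈class
      ...   | inj₁ (refl , _) = e∈
      ...   | inj₂ a∈old = cl-extensive (∈-∖⁺
        (∈-class⁺ (trans (∈-class⁻ a∈old) (recolour-other χ i g≢e))) a≢g)

    -- A redundant element leaves its class without loss of rank. At an exit it raises the rank of
    -- the class that it enters. At a hop it takes the place of `f`, which thereby becomes redundant
    -- and continues along the chain. If the move spoils the rest of the chain, `e` has a strictly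
    -- shorter chain in the old colouring; `N` bounds the length, so the recursion ends.
    augment : ∀ N {m} → m < N → ∀ χ {e} → Redundant χ e → Augmenting χ e m → ∃ λ χ' → totalRank χ < totalRank χ'
    augment _ _ χ {e} red (exit i e∉) = recolour χ e i ,
      ∑-mono-< (allFin k) (λ j → rank-mono (class-recolour i red j)) (∈-allFin i) (begin
        suc (rank (class χ i))         ≡⟨ rank-∷-new e∉ ⟨
        rank (e ∷ class χ i)           ≤⟨ rank-mono (λ { (here refl) → cl-extensive (∈-class⁺ (recolour-same χ e i))
                                                       ; (there a∈) → class-recolour i red i a∈ }) ⟩
        rank (class (recolour χ e i) i) ∎)
      where open ≤-Reasoning
    augment (suc N) (s≤s m<N) χ {e} red (hop {m} f e∉ chain) with e ∈cl? class χ (χ f)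
    ... | no e∉class = augment (suc N) (s≤s z≤n) χ red (exit (χ f) e∉class)
    ... | yes e∈class with augmenting-recolour {e = e} (χ f) chain
    ...   | inj₂ (m' , m'≤m , chain') = augment N (≤-<-trans m'≤m m<N) χ red chain'
    ...   | inj₁ chain' =
      let χ'' , lt = augment N m<N χ' red' chain' in
      χ'' , ≤-<-trans (∑-mono (allFin k) (λ j → rank-mono (class-recolour (χ f) red j))) lt
      where
      χ' = recolour χ e (χ f)
      -- The class of `f` spans `e`, but not without `f`; by exchange, `e` can replace `f` there.
      f∈cl : f ∈cl (e ∷ (class χ (χ f) ∖ f))
      f∈cl = cl-exchange (cl-mono split e∈class) e∉
        where
        split : ∀ {a} → a ∈ class χ (χ f) → a ∈ f ∷ (class χ (χ f) ∖ f)
        split {a} a∈ with a ≟ f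
        ... | yes a≡f = here a≡f
        ... | no a≢f  = there (∈-∖⁺ a∈ a≢f)
      red' : Redundant χ' f
      red' with f ≟ e
      ... | yes refl = contradiction red e∉
      ... | no f≢e = cl-mono incl f∈cl
        where
        incl : ∀ {a} → a ∈ e ∷ (class χ (χ f) ∖ f) → a ∈ class χ' (χ f) ∖ f
        incl (here refl) = ∈-∖⁺ (∈-class⁺ (recolour-same χ e (χ f))) (f≢e ∘ sym)
        incl {a} (there a∈) with ∈-∖⁻ a∈ | a ≟ e
        ... | a∈class , a≢f | yes refl = ∈-∖⁺ (∈-class⁺ (recolour-same χ e (χ f))) a≢f
        ... | a∈class , a≢f | no a≢e   =
          ∈-∖⁺ (∈-class⁺ (trans (recolour-other χ (χ f) a≢e) (∈-class⁻ a∈class))) a≢f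

    private
      Enters : (E → Fin k) → List E → E → Set
      Enters χ N e = (∃ λ i → ¬ e ∈cl class χ i) ⊎ (∃ λ f → f ∈ N × ¬ e ∈cl (class χ (χ f) ∖ f))

      enters? : ∀ χ N e → Dec (Enters χ N e)
      enters? χ N e with any? (λ i → ¬? (e ∈cl? class χ i)) (allFin k)
      ... | yes p = yes (inj₁ (let i , _ , e∉ = find p in i , e∉))
      ... | no ¬p with any? (λ f → ¬? (e ∈cl? (class χ (χ f) ∖ f))) N
      ...   | yes q = yes (inj₂ (find q))
      ...   | no ¬q = no λ { (inj₁ (i , e∉)) → ¬p (lose (∈-allFin i) e∉)
                           ; (inj₂ (f , f∈ , e∉)) → ¬q (lose f∈ e∉) }

      Chained : (E → Fin k) → List E → Set
      Chained χ N = ∀ {e} → e ∈ N → ∃ (Augmenting χ e)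

      outside : List E → ℕ
      outside N = ∑ ground (λ e → 𝟙 (¬? (e ∈? N)))

      -- Collects the elements that start an augmenting chain, by prepending one hop or exit at a
      -- time; `fuel` bounds the number of elements not yet collected.
      saturate : ∀ fuel χ N → outside N < fuel → Chained χ N →
        ∃ λ N' → Chained χ N' × (∀ e → e ∉ N' → ¬ Enters χ N' e)
      saturate (suc fuel) χ N (s≤s lt) chained
        with any? (λ e → ¬? (e ∈? N) ×-dec enters? χ N e) ground
      ... | no none = N , chained , λ e e∉N enters → none (lose (complete e) (e∉N , enters))
      ... | yes some with find some
      ...   | e , e∈ground , e∉N , enters = saturate fuel χ (e ∷ N) (<-≤-trans fewer lt) chained'
        where
        fewer : outside (e ∷ N) < outside N
        fewer = ∑-mono-< ground (λ a → 𝟙-mono (¬? (a ∈? (e ∷ N))) (¬? (a ∈? N)) (_∘ there)) e∈ground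
          (subst (_< 𝟙 (¬? (e ∈? N))) (sym (𝟙-no (¬? (e ∈? (e ∷ N))) (λ e∉ → e∉ (here refl))))
            (≤-reflexive (sym (𝟙-yes (¬? (e ∈? N)) e∉N))))
        chained' : Chained χ (e ∷ N)
        chained' (there a∈) = chained a∈
        chained' (here refl) = [ (λ (i , e∉) → 0 , exit i e∉)
          , (λ (f , f∈ , e∉) → let m , chain = chained f∈ in suc m , hop f e∉ chain) ]′ enters

      -- The certificate of optimality when no chain starts at a redundant element. An element
      -- outside `N` is spanned by every class, even after any one member of `N` is deleted. So the
      -- part of each class off `N` spans the whole complement `R` of `N`, and the members of `N` in
      -- the class add one each to the rank.
      module Stuck (χ : E → Fin k) (N : List E)
        (closed : ∀ e → e ∉ N → ¬ Enters χ N e)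
        (irredundant : ∀ {f} → f ∈ N → ¬ Redundant χ f) where

        -- Suppose that `f` were needed to span some `e` outside `N`. By exchange the remaining
        -- elements and `e` would span `f`; but `e` is spanned by the class of `f` without `f`, so
        -- `f` would be redundant.
        peel : ∀ i B {C} → Unique (B ++ C) → (∀ {a} → a ∈ B ++ C → χ a ≡ i) → (∀ {f} → f ∈ B → f ∈ N) →
          rank (B ++ C) ≡ length B + rank C × (∀ {e} → e ∉ N → e ∈cl (B ++ C) → e ∈cl C)
        peel i []      _        _     _   = refl , λ _ e∈ → e∈
        peel i (f ∷ B) {C} (f∉ ∷ u) col B⊆N =
          trans (rank-∷-new (irr ∘ cl-mono incl)) (cong suc (proj₁ rest)) ,
          λ {e} e∉N e∈ → proj₂ rest e∉N (decidable-stable (e ∈cl? (B ++ C)) λ e∉ →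
            irr (cl-closed (λ { (here refl) → avoid e∉N ; (there a∈) → cl-extensive (incl a∈) })
                           (cl-exchange e∈ e∉)))
          where
          rest = peel i B u (col ∘ there) (B⊆N ∘ there)
          irr = irredundant (B⊆N (here refl))
          incl : ∀ {a} → a ∈ B ++ C → a ∈ class χ (χ f) ∖ f
          incl a∈ = ∈-∖⁺ (∈-class⁺ (trans (col (there a∈)) (sym (col (here refl)))))
                         (λ { refl → All.lookup f∉ a∈ refl })
          avoid : ∀ {e} → e ∉ N → e ∈cl (class χ (χ f) ∖ f)
          avoid {e} e∉N = decidable-stable (e ∈cl? _) λ e∉ → closed e e∉N (inj₂ (f , B⊆N (here refl) , e∉))

        inN? : ∀ i e → Dec (χ e ≡ i × e ∈ N)
        inN? i e = (χ e F.≟ i) ×-dec (e ∈? N)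

        offN? : ∀ i e → Dec (χ e ≡ i × e ∉ N)
        offN? i e = (χ e F.≟ i) ×-dec ¬? (e ∈? N)

        R : List E
        R = filter (λ e → ¬? (e ∈? N)) ground

        rank-class : ∀ i → length (filter (inN? i) ground) + rank R ≤ rank (class χ i)
        rank-class i = begin
          length B + rank R  ≤⟨ +-monoʳ-≤ (length B) (rank-mono spanned) ⟩
          length B + rank C  ≡⟨ proj₁ peeled ⟨
          rank (B ++ C)      ≤⟨ rank-mono (cl-extensive ∘ ∈-class⁺ ∘ col) ⟩
          rank (class χ i)   ∎
          where
          open ≤-Reasoning
          B = filter (inN? i) ground
          C = filter (offN? i) ground
          ∈B : ∀ {a} → a ∈ B → χ a ≡ i × a ∈ N
          ∈B a∈ = proj₂ (∈-filter⁻ (inN? i) {xs = ground} a∈)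
          ∈C : ∀ {a} → a ∈ C → χ a ≡ i × a ∉ N
          ∈C a∈ = proj₂ (∈-filter⁻ (offN? i) {xs = ground} a∈)
          col : ∀ {a} → a ∈ B ++ C → χ a ≡ i
          col a∈ = [ proj₁ ∘ ∈B , proj₁ ∘ ∈C ]′ (∈-++⁻ B a∈)
          peeled = peel i B (Unique.++⁺ (Unique.filter⁺ (inN? i) unique) (Unique.filter⁺ (offN? i) unique)
            (λ (b∈ , c∈) → proj₂ (∈C c∈) (proj₂ (∈B b∈)))) col (proj₂ ∘ ∈B)
          split : ∀ {a} → a ∈ class χ i → a ∈ B ++ C
          split {a} a∈ with a ∈? N
          ... | yes a∈N = ∈-++⁺ˡ (∈-filter⁺ (inN? i) (complete a) (∈-class⁻ a∈ , a∈N))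
          ... | no a∉N  = ∈-++⁺ʳ B (∈-filter⁺ (offN? i) (complete a) (∈-class⁻ a∈ , a∉N))
          spanned : ∀ {e} → e ∈ R → e ∈cl C
          spanned {e} e∈ = proj₂ peeled e∉N (cl-mono split
            (decidable-stable (e ∈cl? _) λ e∉ → closed e e∉N (inj₁ (i , e∉))))
            where e∉N = proj₂ (∈-filter⁻ (λ e → ¬? (e ∈? N)) {xs = ground} e∈)

        totalRank-≥ : ∑ ground (λ e → 𝟙 (¬? (e ∈? R))) + k * rank R ≤ totalRank χ
        totalRank-≥ = begin
          outside R + k * rank R
            ≤⟨ +-mono-≤ (∑-mono ground (λ e → ≤-trans (member e) (∑-member (λ i → 𝟙 (inN? i e)) (∈-allFin (χ e)))))
                        (≤-reflexive (sym (∑-allFin-const k (rank R)))) ⟩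
          ∑ ground (λ e → ∑ (allFin k) (λ i → 𝟙 (inN? i e))) + ∑ (allFin k) (λ _ → rank R)
            ≡⟨ cong (_+ ∑ (allFin k) (λ _ → rank R)) (∑-swap ground (allFin k) _) ⟩
          ∑ (allFin k) (λ i → ∑ ground (λ e → 𝟙 (inN? i e))) + ∑ (allFin k) (λ _ → rank R)
            ≡⟨ ∑-+ (allFin k) _ _ ⟨
          ∑ (allFin k) (λ i → ∑ ground (λ e → 𝟙 (inN? i e)) + rank R)
            ≡⟨ ∑-cong (allFin k) (λ i → cong (_+ rank R) (sym (length-filter-∑ (inN? i) ground))) ⟩
          ∑ (allFin k) (λ i → length (filter (inN? i) ground) + rank R)
            ≤⟨ ∑-mono (allFin k) rank-class ⟩
          totalRank χ ∎
          where
          open ≤-Reasoning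
          member : ∀ e → 𝟙 (¬? (e ∈? R)) ≤ 𝟙 (inN? (χ e) e)
          member e = 𝟙-mono (¬? (e ∈? R)) (inN? (χ e) e) λ e∉R →
            refl , decidable-stable (e ∈? N) λ e∉N → e∉R (∈-filter⁺ _ (complete e) e∉N)

    -- Edmonds' theorem on disjoint bases.
    base-packing : ∀ r → (∀ A → rank A ≤ r) →
      (∀ R → k * r ≤ ∑ ground (λ e → 𝟙 (¬? (e ∈? R))) + k * rank R) →
      (E → Fin k) → ∃ λ χ → ∀ i → rank (class χ i) ≡ r
    base-packing r rank≤r enough χ₀ = go (k * r) χ₀ (m≤n+m _ _)
      where
      full : ∀ χ → k * r ≤ totalRank χ → ∀ i → rank (class χ i) ≡ r
      full χ kr≤ i = ≤-antisym (rank≤r (class χ i)) (≮⇒≥ λ lt → <-irrefl refl (begin-strict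
        totalRank χ             <⟨ ∑-mono-< (allFin k) (rank≤r ∘ class χ) (∈-allFin i) lt ⟩
        ∑ (allFin k) (λ _ → r)  ≡⟨ ∑-allFin-const k r ⟩
        k * r                   ≤⟨ kr≤ ⟩
        totalRank χ             ∎))
        where open ≤-Reasoning
      -- `deficit` bounds how far the total rank is from `k * r`; every augmentation gains at least
      -- one.
      go : ∀ deficit χ → k * r ≤ totalRank χ + deficit → ∃ λ χ → ∀ i → rank (class χ i) ≡ r
      go zero    χ le = χ , full χ (≤-trans le (≤-reflexive (+-identityʳ _)))
      go (suc deficit) χ le with saturate _ χ [] ≤-refl (λ ())
      ... | N , chained , closed with any? (λ f → f ∈cl? (class χ (χ f) ∖ f)) N
      -- `N` now certifies optimality: `enough` at the complement of `N` forces total rank at least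
      -- `k * r`, whatever deficit was allowed.
      ...   | no none = χ , full χ (≤-trans (enough _) (Stuck.totalRank-≥ χ N closed λ f∈ red → none (lose f∈ red)))
      ...   | yes some =
        let f , f∈ , red = find some
            _ , chain = chained f∈
            χ' , lt = augment _ ≤-refl χ red chain
        in go deficit χ' (≤-trans le (≤-trans (≤-reflexive (+-suc _ _)) (+-monoˡ-≤ deficit lt)))

-- Concatenation, reversal and mapping of walks

module _ {V : Set} {E : V → V → Set} where

  _++ʷ_ : ∀ {x y z} → Walk E x y → Walk E y z → Walk E x z
  here     ++ʷ v = v
  step e w ++ʷ v = step e (w ++ʷ v)

  reverseʷ : (∀ {x y} → E x y → E y x) → ∀ {x y} → Walk E x y → Walk E y x
  reverseʷ flip here       = here
  reverseʷ flip (step e w) = reverseʷ flip w ++ʷ step (flip e) here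

mapʷ : {V : Set} {E F : V → V → Set} → (∀ {x y} → E x y → F x y) → ∀ {x y} → Walk E x y → Walk F x y
mapʷ f here       = here
mapʷ f (step e w) = step (f e) (mapʷ f w)

-- The cycle matroid of a multigraph

module Graphic {n : ℕ} {E : Set} (src tgt : E → Fin n) where

  merge : Fin n → Fin n → Fin n → Fin n
  merge a b y with y ≟ a
  ... | yes _ = b
  ... | no _  = y

  merge-same : ∀ a b → merge a b a ≡ b
  merge-same a b with a ≟ a
  ... | yes _  = refl
  ... | no a≢a = contradiction refl a≢a

  merge-other : ∀ {a} b {y} → y ≢ a → merge a b y ≡ y
  merge-other {a} b {y} y≢a with y ≟ a
  ... | yes y≡a = contradiction y≡a y≢a
  ... | no _    = refl

  merge-target : ∀ a b → merge a b b ≡ b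
  merge-target a b with b ≟ a
  ... | yes _ = refl
  ... | no _  = refl

  merge-split : ∀ {a b y z} → merge a b y ≡ merge a b z → y ≡ z ⊎ ((y ≡ a ⊎ y ≡ b) × (z ≡ a ⊎ z ≡ b))
  merge-split {a} {b} {y} {z} eq with y ≟ a | z ≟ a
  ... | yes p | yes q = inj₁ (trans p (sym q))
  ... | yes p | no _  = inj₂ (inj₁ p , inj₂ (sym eq))
  ... | no _  | yes q = inj₂ (inj₂ eq , inj₁ q)
  ... | no _  | no _  = inj₁ eq

  -- A representative of the component of each vertex.
  label : List E → Fin n → Fin n
  label []      x = x
  label (e ∷ A) x = merge (label A (src e)) (label A (tgt e)) (label A x)

  Respects : (Fin n → Fin n) → List E → Set
  Respects f A = ∀ {e} → e ∈ A → f (src e) ≡ f (tgt e)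

  -- The universal property of the components: every function that is constant along the edges of
  -- `A` factors through `label A`. Idempotence and the closure axioms of the matroid are derived
  -- from it.
  label-factor : ∀ A f → Respects f A → ∀ x → f (label A x) ≡ f x
  label-factor []      f resp x = refl
  label-factor (e ∷ A) f resp x with label A x ≟ label A (src e)
  ... | no _ = label-factor A f (resp ∘ there) x
  ... | yes eq = begin
    f (label A (tgt e))  ≡⟨ label-factor A f (resp ∘ there) (tgt e) ⟩
    f (tgt e)            ≡⟨ resp (here refl) ⟨
    f (src e)            ≡⟨ label-factor A f (resp ∘ there) (src e) ⟨
    f (label A (src e))  ≡⟨ cong f eq ⟨
    f (label A x)        ≡⟨ label-factor A f (resp ∘ there) x ⟩
    f x                  ∎
    where open ≡-Reasoning

  label-respects : ∀ A → Respects (label A) A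
  label-respects (e ∷ A) (here refl) =
    trans (merge-same (label A (src e)) _) (sym (merge-target (label A (src e)) _))
  label-respects (e ∷ A) (there f∈) = cong (merge _ _) (label-respects A f∈)

  label-idem : ∀ A x → label A (label A x) ≡ label A x
  label-idem A = label-factor A (label A) (label-respects A)

  _∈cl_ : E → List E → Set
  e ∈cl A = label A (src e) ≡ label A (tgt e)

  _∈cl?_ : ∀ e A → Dec (e ∈cl A)
  e ∈cl? A = label A (src e) ≟ label A (tgt e)

  label-coarsen : ∀ {A B} → (∀ {a} → a ∈ A → a ∈cl B) → ∀ {x y} → label A x ≡ label A y → label B x ≡ label B y
  label-coarsen {A} {B} A⊆ {x} {y} eq =
    trans (sym (label-factor A (label B) A⊆ x)) (trans (cong (label B) eq) (label-factor A (label B) A⊆ y))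

  -- If `f` becomes spanned only through `e`, then both edges join the same two components of `A`,
  -- so merging along `f` also unites the ends of `e`.
  cl-exchange : ∀ {e f A} → f ∈cl (e ∷ A) → ¬ (f ∈cl A) → e ∈cl (f ∷ A)
  cl-exchange {e} {f} {A} f∈ f∉ with merge-split f∈
  ... | inj₁ eq = contradiction eq f∉
  ... | inj₂ (inj₁ p , inj₁ q) = contradiction (trans p (sym q)) f∉
  ... | inj₂ (inj₂ p , inj₂ q) = contradiction (trans p (sym q)) f∉
  ... | inj₂ (inj₁ p , inj₂ q) =
    subst₂ (λ a b → merge _ _ a ≡ merge _ _ b) p q (label-respects (f ∷ A) (here refl))
  ... | inj₂ (inj₂ p , inj₁ q) =
    subst₂ (λ a b → merge _ _ b ≡ merge _ _ a) p q (sym (label-respects (f ∷ A) (here refl)))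

  open Matroid _∈cl_ _∈cl?_ (λ {_} {A} → label-respects A) (λ {A} {B} A⊆ → label-coarsen {A} {B} A⊆)
    (λ {e} {f} {A} → cl-exchange {e} {f} {A}) public

  label-∷-spanned : ∀ {e} A → e ∈cl A → ∀ x → label (e ∷ A) x ≡ label A x
  label-∷-spanned {e} A e∈ x with label A x ≟ label A (src e)
  ... | yes eq = trans (sym e∈) (sym eq)
  ... | no _   = refl

  -- Counts the fixed points, that is the representatives: for an idempotent map there is exactly
  -- one in each block.
  components : (Fin n → Fin n) → ℕ
  components ℓ = ∑ (allFin n) (λ x → 𝟙 (ℓ x ≟ x))

  -- An edge that is not spanned by `A` destroys exactly one representative, `label A (src e)`.
  rank+components : ∀ A → rank A + components (label A) ≡ n
  rank+components [] = trans (∑-cong (allFin n) (λ x → 𝟙-yes (x ≟ x) refl))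
                             (trans (∑-allFin-const n 1) (*-identityʳ n))
  rank+components (e ∷ A) with e ∈cl? A
  ... | yes e∈ = trans (cong (rank A +_) (∑-cong (allFin n) λ x → cong (λ y → 𝟙 (y ≟ x)) (label-∷-spanned A e∈ x)))
                       (rank+components A)
  ... | no e∉ = trans (sym (+-suc (rank A) _)) (trans (cong (rank A +_) (sym one-fewer)) (rank+components A))
    where
    a = label A (src e)
    b = label A (tgt e)
    pointwise : ∀ x → 𝟙 (label A x ≟ x) ≡ 𝟙 (x ≟ a) + 𝟙 (label (e ∷ A) x ≟ x)
    pointwise x with x ≟ a
    ... | yes refl = trans (𝟙-yes (label A a ≟ a) (label-idem A (src e)))
      (cong suc (sym (𝟙-no (label (e ∷ A) a ≟ a) λ eq → e∉ (trans (sym eq)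
        (trans (cong (merge a b) (label-idem A (src e))) (merge-same a b))))))
    ... | no x≢a = 𝟙-cong (label A x ≟ x) (label (e ∷ A) x ≟ x)
      (λ eq → trans (merge-other b (λ ax → x≢a (trans (sym eq) ax))) eq)
      back
      where
      back : label (e ∷ A) x ≡ x → label A x ≡ x
      back eq with label A x ≟ a
      ... | no _  = eq
      ... | yes p = contradiction (trans (sym p) (trans (cong (label A) (sym eq)) (label-idem A (tgt e)))) e∉
    one-fewer : components (label A) ≡ suc (components (label (e ∷ A)))
    one-fewer = trans (∑-cong (allFin n) pointwise) (trans (∑-+ (allFin n) (λ x → 𝟙 (x ≟ a)) _)
      (cong (_+ components (label (e ∷ A))) (trans
        (∑-single (λ x → 𝟙 (x ≟ a)) (Unique.allFin⁺ n) (∈-allFin a) (λ x → 𝟙-no (x ≟ a)))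
        (𝟙-yes (a ≟ a) refl))))

  components≥1 : Fin n → ∀ A → 1 ≤ components (label A)
  components≥1 x A = ≤-trans (≤-reflexive (sym (𝟙-yes (label A (label A x) ≟ label A x) (label-idem A x))))
    (∑-member (λ x → 𝟙 (label A x ≟ x)) (∈-allFin (label A x)))

  components≡1⇒connected : ∀ A → components (label A) ≡ 1 → ∀ x y → label A x ≡ label A y
  components≡1⇒connected A one x y = decidable-stable (a ≟ b) λ a≢b →
    contradiction (≤-trans (two a≢b) (≤-reflexive one)) λ { (s≤s ()) }
    where
    a = label A x
    b = label A y
    count : ∀ c → ∑ (allFin n) (λ x → 𝟙 (x ≟ c)) ≡ 1
    count c = trans (∑-single (λ x → 𝟙 (x ≟ c)) (Unique.allFin⁺ n) (∈-allFin c) (λ x → 𝟙-no (x ≟ c)))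
                    (𝟙-yes (c ≟ c) refl)
    two : a ≢ b → 2 ≤ components (label A)
    two a≢b = subst (_≤ components (label A)) (trans (∑-+ (allFin n) _ _) (cong₂ _+_ (count a) (count b)))
      (∑-mono (allFin n) pointwise)
      where
      pointwise : ∀ z → 𝟙 (z ≟ a) + 𝟙 (z ≟ b) ≤ 𝟙 (label A z ≟ z)
      pointwise z with z ≟ a | z ≟ b
      ... | yes p | yes q = contradiction (trans (sym p) q) a≢b
      ... | yes refl | no _ = ≤-reflexive (sym (𝟙-yes (label A z ≟ z) (label-idem A x)))
      ... | no _ | yes refl = ≤-reflexive (sym (𝟙-yes (label A z ≟ z) (label-idem A y)))
      ... | no _ | no _ = z≤n

  Joins : E → Fin n → Fin n → Set
  Joins e x y = (src e ≡ x × tgt e ≡ y) ⊎ (src e ≡ y × tgt e ≡ x)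

  Via : List E → Fin n → Fin n → Set
  Via A x y = ∃ λ e → e ∈ A × Joins e x y

  Via-sym : ∀ {A x y} → Via A x y → Via A y x
  Via-sym (e , e∈ , j) = e , e∈ , Sum.swap j

  label-walk : ∀ A x → Walk (Via A) x (label A x)
  label-walk []      x = here
  label-walk (e ∷ A) x with label A x ≟ label A (src e)
  ... | no _   = mapʷ weaken (label-walk A x)
    where
    weaken : ∀ {x y} → Via A x y → Via (e ∷ A) x y
    weaken (f , f∈ , j) = f , there f∈ , j
  ... | yes eq = subst (Walk _ x) eq (walk x)
      ++ʷ (reverseʷ Via-sym (walk (src e)) ++ʷ step (e , here refl , inj₁ (refl , refl)) (walk (tgt e)))
    where
    walk : ∀ x → Walk (Via (e ∷ A)) x (label A x)
    walk x = mapʷ (λ (f , f∈ , j) → f , there f∈ , j) (label-walk A x)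

  connected-walk : ∀ {A} → (∀ x y → label A x ≡ label A y) → Connected (Via A)
  connected-walk {A} conn x y = subst (Walk _ x) (conn x y) (label-walk A x) ++ʷ reverseʷ Via-sym (label-walk A y)

  Incident : Fin n → E → Set
  Incident x e = x ≡ src e ⊎ x ≡ tgt e

  private
    -- Orient the component of each x towards its root ρ x; q x is the edge leaving x.
    Orientation : List E → (Fin n → Fin n) → Set
    Orientation A ρ = Σ (Fin n → E) λ q →
      (∀ {x} → x ≢ ρ x → q x ∈ A × Incident x (q x)) ×
      (∀ {x y} → x ≢ ρ x → y ≢ ρ y → q x ≡ q y → x ≡ y)

    reroot : List E → Fin n → (Fin n → Fin n) → Fin n → Fin n
    reroot A v ρ x with label A x ≟ label A v
    ... | yes _ = v
    ... | no _  = ρ x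

    -- With the component of `v` rerooted at `v`, every vertex but `v` already has its edge in `A`;
    -- `e` is the edge leaving `v`, and `e ∉ A` keeps the choice injective.
    orient-∷ : ∀ {A e ρ} v → e ∉ A → Incident v e → Orientation A (reroot A v ρ) → Orientation (e ∷ A) ρ
    orient-∷ {A} {e} {ρ} v e∉ v∈e (q' , inc' , inj') = q , (λ {x} → inc x) , (λ {x} {y} → inj x y)
      where
      q : Fin n → E
      q x with x ≟ v
      ... | yes _ = e
      ... | no _  = q' x
      still : ∀ {x} → x ≢ v → x ≢ ρ x → x ≢ reroot A v ρ x
      still {x} x≢v x≢ρx with label A x ≟ label A v
      ... | yes _ = x≢v
      ... | no _  = x≢ρx
      inc : ∀ x → x ≢ ρ x → q x ∈ e ∷ A × Incident x (q x)
      inc x x≢ρx with x ≟ v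
      ... | yes refl = here refl , v∈e
      ... | no x≢v   = let q∈ , i = inc' (still x≢v x≢ρx) in there q∈ , i
      inj : ∀ x y → x ≢ ρ x → y ≢ ρ y → q x ≡ q y → x ≡ y
      inj x y x≢ρx y≢ρy eq with x ≟ v | y ≟ v
      ... | yes refl | yes refl = refl
      ... | yes refl | no y≢v = contradiction (subst (_∈ A) (sym eq) (proj₁ (inc' (still y≢v y≢ρy)))) e∉
      ... | no x≢v | yes refl = contradiction (subst (_∈ A) eq (proj₁ (inc' (still x≢v x≢ρx)))) e∉
      ... | no x≢v | no y≢v = inj' (still x≢v x≢ρx) (still y≢v y≢ρy) eq

    -- Edges already spanned are skipped. An edge `e` joining two components of `A` has the root `ρ`
    -- on one side; the component on the other side is rerooted at its end of `e`, which then leaves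
    -- through `e`.
    orient : E → ∀ A → Unique A → ∀ ρ → (∀ {x y} → label A x ≡ label A y → ρ x ≡ ρ y) →
      (∀ x → label A (ρ x) ≡ label A x) → Orientation A ρ
    -- Without edges every vertex is its own root and asks for no edge, so `e₀` is a mere filler.
    orient e₀ [] _ ρ _ inside = (λ _ → e₀) , (λ {x} x≢ → contradiction (sym (inside x)) x≢)
                                          , (λ {x} x≢ → contradiction (sym (inside x)) x≢)
    orient e₀ (e ∷ A) (e∉ ∷ u) ρ const inside with e ∈cl? A
    ... | yes e∈ =
      let q , inc , inj = orient e₀ A u ρ (const ∘ cong (merge _ _))
            (λ x → trans (sym (label-∷-spanned A e∈ (ρ x))) (trans (inside x) (label-∷-spanned A e∈ x)))
      in q , (λ x≢ → let q∈ , i = inc x≢ in there q∈ , i) , inj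
    ... | no e∉cl = [ (λ p → orient-∷ (tgt e) e∉A (inj₂ refl) (rerooted (tgt e) (src e) Sum.swap p))
                    , (λ p → orient-∷ (src e) e∉A (inj₁ refl) (rerooted (src e) (tgt e) id p)) ]′ root-side
      where
      e∉A : e ∉ A
      e∉A e∈ = All.lookup e∉ e∈ refl
      ends : label (e ∷ A) (src e) ≡ label (e ∷ A) (tgt e)
      ends = label-respects (e ∷ A) (here refl)
      root-side : label A (ρ (src e)) ≡ label A (src e) ⊎ label A (ρ (tgt e)) ≡ label A (tgt e)
      root-side with merge-split (inside (src e))
      ... | inj₁ p = inj₁ p
      ... | inj₂ (inj₁ p , _) = inj₁ p
      ... | inj₂ (inj₂ p , _) = inj₂ (trans (cong (label A) (sym (const ends))) p)
      rerooted : ∀ v w → (∀ {y} → y ≡ label A (src e) ⊎ y ≡ label A (tgt e) → y ≡ label A v ⊎ y ≡ label A w) →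
        label A (ρ w) ≡ label A w → Orientation A (reroot A v ρ)
      rerooted v w near root = orient e₀ A u (reroot A v ρ) (λ {x} {y} → const' x y) inside'
        where
        const' : ∀ x y → label A x ≡ label A y → reroot A v ρ x ≡ reroot A v ρ y
        const' x y eq with label A x ≟ label A v | label A y ≟ label A v
        ... | yes _ | yes _ = refl
        ... | yes p | no q  = contradiction (trans (sym eq) p) q
        ... | no p  | yes q = contradiction (trans eq q) p
        ... | no _  | no _  = const (cong (merge _ _) eq)
        inside' : ∀ x → label A (reroot A v ρ x) ≡ label A x
        inside' x with label A x ≟ label A v
        ... | yes p = sym p
        ... | no x≢v with merge-split (inside x)
        ...   | inj₁ p = p
        ...   | inj₂ (_ , near-x) with near near-x
        ...     | inj₁ p = contradiction p x≢v
        ...     | inj₂ p = trans (cong (label A) (const (cong (merge _ _) p))) (trans root (sym p))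

  -- The spanning structure is rooted at an end of `e₀`. Every other vertex takes its edge towards
  -- the root, and the root takes `e₀`.
  unicyclic-orientation : ∀ {A e₀} → Unique A → e₀ ∉ A → (∀ x y → label A x ≡ label A y) →
    Σ (Fin n → E) λ q → (∀ x → q x ∈ e₀ ∷ A × Incident x (q x)) × (∀ {x y} → q x ≡ q y → x ≡ y)
  unicyclic-orientation {A} {e₀} u e₀∉ conn = q , inc , (λ {x} {y} → inj x y)
    where
    r = src e₀
    tree = orient e₀ A u (λ _ → r) (λ _ → refl) (λ x → conn r x)
    q' = proj₁ tree
    q : Fin n → E
    q x with x ≟ r
    ... | yes _ = e₀
    ... | no _  = q' x
    inc : ∀ x → q x ∈ e₀ ∷ A × Incident x (q x)
    inc x with x ≟ r
    ... | yes refl = here refl , inj₁ refl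
    ... | no x≢r   = let q∈ , i = proj₁ (proj₂ tree) x≢r in there q∈ , i
    inj : ∀ x y → q x ≡ q y → x ≡ y
    inj x y eq with x ≟ r | y ≟ r
    ... | yes refl | yes refl = refl
    ... | yes refl | no y≢r = contradiction (subst (_∈ A) (sym eq) (proj₁ (proj₁ (proj₂ tree) y≢r))) e₀∉
    ... | no x≢r | yes refl = contradiction (subst (_∈ A) eq (proj₁ (proj₁ (proj₂ tree) x≢r))) e₀∉
    ... | no x≢r | no y≢r = proj₂ (proj₂ tree) x≢r y≢r eq

-- Spanning trees from parent functions

module _ {V : Set} {E : V → V → Set} where

  first∈verts : ∀ {u v} (w : Walk E u v) → u ∈ verts w
  first∈verts here       = here refl
  first∈verts (step _ _) = here refl

  last∈verts : ∀ {u v} (w : Walk E u v) → v ∈ verts w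
  last∈verts here       = here refl
  last∈verts (step _ w) = there (last∈verts w)

  ∈edges⇒E : ∀ {u v} (w : Walk E u v) {a b} → (a , b) ∈ edges w → E a b
  ∈edges⇒E (step e w) (here refl) = e
  ∈edges⇒E (step e w) (there ab∈) = ∈edges⇒E w ab∈

module ParentTree {V : Set} (_≟_ : DecidableEquality V) (root : V) (parent : V → V) (height : V → ℕ)
  (height-parent : ∀ {u} → u ≢ root → height (parent u) < height u) where

  Child : V → V → Set
  Child u v = u ≢ root × parent u ≡ v

  Tree : V → V → Set
  Tree u v = Child u v ⊎ Child v u

  child-height : ∀ {u v} → Child u v → height v < height u
  child-height (u≢ , refl) = height-parent u≢

  tree-connected : Connected Tree
  tree-connected u v = to-root u (<-wellFounded _) ++ʷ reverseʷ Sum.swap (to-root v (<-wellFounded _))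
    where
    to-root : ∀ u → Acc _<_ (height u) → Walk Tree u root
    to-root u (acc rs) with u ≟ root
    ... | yes refl = here
    ... | no u≢    = step (inj₁ (u≢ , refl)) (to-root (parent u) (rs (height-parent u≢)))

  private
    -- A path that has gone down once keeps going down.
    descent : ∀ {x v z} (w : Walk Tree x v) → Unique (z ∷ verts w) → Child x z →
      height x ≤ height v × (v ≡ x ⊎ ∃ λ y → y ∈ verts w × Child v y)
    descent here _ _ = ≤-refl , inj₁ refl
    descent (step (inj₁ (_ , refl)) w) (z∉ ∷ _) (_ , refl) =
      contradiction refl (All.lookup z∉ (there (first∈verts w)))
    descent {x} (step (inj₂ y-x) w) (_ ∷ u) _ with descent w u y-x
    ... | le , inj₁ refl             = <⇒≤ (<-≤-trans (child-height y-x) le) , inj₂ (x , here refl , y-x)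
    ... | le , inj₂ (y , y∈ , child) = <⇒≤ (<-≤-trans (child-height y-x) le) , inj₂ (y , there y∈ , child)

    -- A path first moves towards the root; from its first step away from the root on, `descent`
    -- applies.
    ascent : ∀ {u v} (w : Walk Tree u v) → Unique (verts w) →
      height v ≤ height u ⊎ ∃ λ y → y ∈ verts w × Child v y
    ascent here _ = inj₁ ≤-refl
    ascent (step (inj₁ u-x) w) (_ ∷ uniq) with ascent w uniq
    ... | inj₁ le               = inj₁ (≤-trans le (<⇒≤ (child-height u-x)))
    ... | inj₂ (y , y∈ , child) = inj₂ (y , there y∈ , child)
    ascent {u} (step (inj₂ x-u) w) uniq with descent w uniq x-u
    ... | _ , inj₁ refl               = inj₂ (u , here refl , x-u)
    ... | _ , inj₂ (y , y∈ , child)   = inj₂ (y , there y∈ , child)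

  -- Four cases by the directions of the first and the closing edge. Parents are unique and the path
  -- from `x` to `b` avoids `a`, so it cannot reach `b` from a parent `a`; what remains contradicts
  -- the heights or makes `x` equal to `b`.
  tree-acyclic : Acyclic Tree
  tree-acyclic (a , b , (step t here , _) , s≤s () , _)
  tree-acyclic (a , b , (step {x = x} t w@(step _ w') , a∉ ∷ x∉ ∷ u) , _ , b-a) = close t b-a
    where
    x≢b : x ≢ b
    x≢b refl = All.lookup x∉ (last∈verts w') refl
    not-a : ∀ {y} → y ∈ verts w → Child b y → ¬ Child b a
    not-a y∈ (_ , refl) (_ , refl) = All.lookup a∉ y∈ refl
    close : Tree a x → Tree b a → ⊥
    close (inj₁ a-x) (inj₁ b-a) with ascent w (x∉ ∷ u)
    ... | inj₁ le = <-irrefl refl (<-trans (≤-<-trans le (child-height a-x)) (child-height b-a))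
    ... | inj₂ (_ , y∈ , child) = not-a y∈ child b-a
    close (inj₂ x-a) (inj₁ b-a) with descent w (a∉ ∷ x∉ ∷ u) x-a
    ... | _ , inj₁ b≡x = x≢b (sym b≡x)
    ... | _ , inj₂ (_ , y∈ , child) = not-a y∈ child b-a
    close (inj₁ (_ , refl)) (inj₂ (_ , refl)) = x≢b refl
    close (inj₂ x-a) (inj₂ a-b) =
      <-irrefl refl (<-≤-trans (<-trans (child-height a-b) (child-height x-a)) (proj₁ (descent w (a∉ ∷ x∉ ∷ u) x-a)))

-- Breadth-first search trees

least : {P : ℕ → Set} → Decidable P → ∀ m → P m → ∃ λ l → P l × (∀ j → P j → l ≤ j)
least P? zero    pm = 0 , pm , λ _ _ → z≤n
least P? (suc m) pm with P? 0
... | yes p0 = 0 , p0 , λ _ _ → z≤n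
... | no ¬p0 = let l , pl , min = least (P? ∘ suc) m pm in
  suc l , pl , λ { zero p → contradiction p ¬p0 ; (suc j) p → s≤s (min j p) }

module _ {V : Set} (all : List V) (complete : ∀ v → v ∈ all) {E : V → V → Set} (E? : ∀ u v → Dec (E u v))
  (_≟_ : DecidableEquality V) (root : V) where

  private
    Reach : ℕ → V → Set
    Reach zero    u = u ≡ root
    Reach (suc m) u = ∃ λ w → E w u × Reach m w

    reach? : ∀ u m → Dec (Reach m u)
    reach? u zero    = u ≟ root
    reach? u (suc m) = map′ (λ p → let w , _ , q = find p in w , q) (λ (w , q) → lose (complete w) q)
      (any? (λ w → E? w u ×-dec reach? w m) all)

    walk⇒reach : ∀ m {w u} → Reach m w → Walk E w u → ∃ λ m → Reach m u
    walk⇒reach m r here       = m , r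
    walk⇒reach m r (step e w) = walk⇒reach (suc m) (_ , e , r) w

  abstract
    -- On `S` the height is the distance from `root`, and the parent is the vertex before the last
    -- on a shortest walk. Values outside `S` are fillers.
    bfs : {S : V → Set} → Decidable S → (∀ {u v} → E u v → S u) → (∀ {u} → S u → Walk E root u) →
      Σ (V → V) λ parent → Σ (V → ℕ) λ height →
        ∀ {u} → S u → u ≢ root → E (parent u) u × height (parent u) < height u
    bfs {S} S? E⇒S walk = proj₁ ∘ parent , height , λ {u} → proj₂ (parent u)
      where
      depth : ∀ {u} → S u → ∃ λ l → Reach l u × (∀ j → Reach j u → l ≤ j)
      depth {u} s = let m , r = walk⇒reach 0 refl (walk s) in least (reach? u) m r
      height : V → ℕ
      height u with S? u
      ... | yes s = proj₁ (depth s)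
      ... | no _  = 0
      height≤ : ∀ {u} j → S u → Reach j u → height u ≤ j
      height≤ {u} j s r with S? u
      ... | yes s' = proj₂ (proj₂ (depth s')) j r
      ... | no ¬s  = contradiction s ¬s
      parent : ∀ u → Σ V λ p → S u → u ≢ root → E p u × height p < height u
      parent u with S? u
      ... | no ¬s = root , λ s → contradiction s ¬s
      ... | yes s with depth s
      ...   | zero , r , _ = root , λ _ u≢ → contradiction r u≢
      ...   | suc m , (w , e , r) , _ = w , λ _ _ → e , s≤s (height≤ m (E⇒S e) r)

-- Araki's criterion: the connected classes of a vertex partition become the inner vertices of the
-- trees, and every vertex outside class i hangs on tree i as a leaf at attach i v.
module _ {V : Set} (_≟_ : DecidableEquality V) (all : List V) (complete : ∀ v → v ∈ all)
  {H : V → V → Set} (H? : ∀ u v → Dec (H u v)) (H-sym : ∀ {u v} → H u v → H v u)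
  {k : ℕ} (χ : V → Fin k) (root : Fin k → V)
  (class-connected : ∀ {i v} → χ v ≡ i → Walk (λ a b → H a b × χ a ≡ i × χ b ≡ i) (root i) v)
  (attach : Fin k → V → V)
  (attach-colour : ∀ {i v} → χ v ≢ i → χ (attach i v) ≡ i)
  (attach-adj : ∀ {i v} → χ v ≢ i → H v (attach i v))
  (attach-antisym : ∀ {i j a b} → i ≢ j → χ a ≡ i → χ b ≡ j → attach i b ≡ a → attach j a ≡ b → ⊥)
  where

  private
    module _ (i : Fin k) where

      search = bfs all complete (λ a b → H? a b ×-dec ((χ a F.≟ i) ×-dec (χ b F.≟ i))) _≟_ (root i)
        (λ v → χ v F.≟ i) (λ (_ , p , _) → p) class-connected

      inner-parent = proj₁ search
      inner-height = proj₁ (proj₂ search)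

      parent : V → V
      parent v with χ v F.≟ i
      ... | yes _ = inner-parent v
      ... | no _  = attach i v

      height : V → ℕ
      height v with χ v F.≟ i
      ... | yes _ = inner-height v
      ... | no _  = suc (inner-height (attach i v))

      height-inner : ∀ {v} → χ v ≡ i → height v ≡ inner-height v
      height-inner {v} p with χ v F.≟ i
      ... | yes _ = refl
      ... | no ¬p = contradiction p ¬p

      parent-spec : ∀ {v} → v ≢ root i → H v (parent v) × χ (parent v) ≡ i × height (parent v) < height v
      parent-spec {v} v≢ with χ v F.≟ i
      ... | no ¬p = attach-adj ¬p , attach-colour ¬p ,
        s≤s (≤-reflexive (height-inner (attach-colour ¬p)))
      ... | yes p = let (adj , q , _) , lt = proj₂ (proj₂ search) p v≢ in
        H-sym adj , q , subst (_< inner-height v) (sym (height-inner q)) lt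

      parent-outer : ∀ {v} → χ v ≢ i → parent v ≡ attach i v
      parent-outer {v} ¬p with χ v F.≟ i
      ... | yes p = contradiction p ¬p
      ... | no _  = refl

      open ParentTree _≟_ (root i) parent height (λ v≢ → proj₂ (proj₂ (parent-spec v≢))) public

      child-colour : ∀ {u v} → Child u v → χ v ≡ i
      child-colour (u≢ , refl) = proj₁ (proj₂ (parent-spec u≢))

      tree⊆H : ∀ u v → Tree u v → H u v
      tree⊆H u v (inj₁ (u≢ , refl)) = proj₁ (parent-spec u≢)
      tree⊆H u v (inj₂ (v≢ , refl)) = H-sym (proj₁ (parent-spec v≢))

      leaf : ∀ {u v} → χ u ≢ i → Tree u v → attach i u ≡ v
      leaf ¬p (inj₁ (_ , refl)) = sym (parent-outer ¬p)
      leaf ¬p (inj₂ child)      = contradiction (child-colour child) ¬p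

      -- A vertex outside class `i` has a single neighbour in tree `i`, so a path that passes
      -- through it would revisit that neighbour.
      interior : ∀ {z x v} (w : Walk Tree x v) → Tree z x → Unique (z ∷ verts w) →
        ∀ {y} → y ∈ verts w → y ≡ v ⊎ χ y ≡ i
      interior here _ _ (here refl) = inj₁ refl
      interior {x = x} (step e w) t ((_ ∷ z∉) ∷ u) (here refl) = inj₂ (decidable-stable (χ x F.≟ i) λ ¬p →
        All.lookup z∉ (first∈verts w) (trans (sym (leaf ¬p (Sum.swap t))) (leaf ¬p e)))
      interior (step e w) t (_ ∷ u) (there y∈) = interior w e u y∈

      path-interior : ∀ {u v} (P : Path Tree u v) {y} → y ∈ verts (proj₁ P) → y ≡ u ⊎ y ≡ v ⊎ χ y ≡ i
      path-interior (here , _) (here refl)         = inj₁ refl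
      path-interior (step e w , _) (here refl)     = inj₁ refl
      path-interior (step e w , u) (there y∈)      = inj₂ (interior w e u y∈)

    -- Parents in tree `i` have colour `i`. An edge common to trees `i` and `j` thus has one end of
    -- each colour, and each end hangs on the other, which `attach-antisym` forbids.
    trees-disjoint : ∀ {i j} → i ≢ j → ∀ {a b} → Tree i a b → ¬ Tree j a b
    trees-disjoint {i} {j} i≢j {a} {b} s t = [ at-b s t , at-a s t ]′ (colours i s)
      where
      colours : ∀ i {a b} → Tree i a b → χ b ≡ i ⊎ χ a ≡ i
      colours i = Sum.map (child-colour i) (child-colour i)
      mixed : ∀ {a b} → Tree i a b → Tree j a b → χ a ≡ i → ¬ χ b ≡ j
      mixed s t p q = attach-antisym i≢j p q
        (leaf i (λ r → i≢j (trans (sym r) q)) (Sum.swap s)) (leaf j (λ r → i≢j (trans (sym p) r)) t)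
      at-a : ∀ {a b} → Tree i a b → Tree j a b → ¬ χ a ≡ i
      at-a s t p = [ mixed s t p , (λ q → i≢j (trans (sym p) q)) ]′ (colours j t)
      at-b : ∀ {a b} → Tree i a b → Tree j a b → ¬ χ b ≡ i
      at-b s t = at-a (Sum.swap s) (Sum.swap t)

  partition⇒CISTs : HasCISTs H k
  partition⇒CISTs = Tree , (λ i → tree⊆H i , (λ _ _ → Sum.swap) , tree-connected i , tree-acyclic i) , independent
    where
    independent : CompletelyIndependent k Tree
    independent i j i≢j u v u≢v P Q =
      (λ a b ab∈ → let s = ∈edges⇒E (proj₁ P) ab∈ in
        (λ ab∈' → trees-disjoint i≢j s (∈edges⇒E (proj₁ Q) ab∈')) ,
        (λ ba∈ → trees-disjoint i≢j s (Sum.swap (∈edges⇒E (proj₁ Q) ba∈)))) ,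
      λ x x∈P x∈Q → inner (path-interior i P x∈P) (path-interior j Q x∈Q)
      where
      inner : ∀ {x} → x ≡ u ⊎ x ≡ v ⊎ χ x ≡ i → x ≡ u ⊎ x ≡ v ⊎ χ x ≡ j → x ≡ u ⊎ x ≡ v
      inner (inj₁ p)        _               = inj₁ p
      inner (inj₂ (inj₁ p)) _               = inj₂ p
      inner _               (inj₁ q)        = inj₁ q
      inner _               (inj₂ (inj₁ q)) = inj₂ q
      inner (inj₂ (inj₂ p)) (inj₂ (inj₂ q)) = contradiction (trans (sym p) q) i≢j

-- Filtering into dependent pairs and counting members of lists

module _ {A : Set} {P : A → Set} (P? : ∀ x → Dec (P x)) where

  filterΣ : List A → List (Σ A P)
  filterΣ []       = []
  filterΣ (x ∷ xs) with P? x
  ... | yes p = (x , p) ∷ filterΣ xs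
  ... | no _  = filterΣ xs

  ∈-filterΣ⁻ : ∀ xs {y} → y ∈ filterΣ xs → proj₁ y ∈ xs
  ∈-filterΣ⁻ (x ∷ xs) y∈ with P? x
  ∈-filterΣ⁻ (x ∷ xs) (here refl) | yes _ = here refl
  ∈-filterΣ⁻ (x ∷ xs) (there y∈)  | yes _ = there (∈-filterΣ⁻ xs y∈)
  ∈-filterΣ⁻ (x ∷ xs) y∈          | no _  = there (∈-filterΣ⁻ xs y∈)

  filterΣ-unique : ∀ {xs} → Unique xs → Unique (filterΣ xs)
  filterΣ-unique [] = []
  filterΣ-unique {x ∷ xs} (x∉ ∷ u) with P? x
  ... | yes p = All.tabulate (λ y∈ → λ { refl → All.lookup x∉ (∈-filterΣ⁻ xs y∈) refl }) ∷ filterΣ-unique u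
  ... | no _  = filterΣ-unique u

  ∈-filterΣ⁺ : (∀ {x} (p q : P x) → p ≡ q) → ∀ {xs x} (p : P x) → x ∈ xs → (x , p) ∈ filterΣ xs
  ∈-filterΣ⁺ irr {x ∷ _} p x∈ with P? x
  ∈-filterΣ⁺ irr {x ∷ _} p (here refl) | yes q = here (cong (x ,_) (irr p q))
  ∈-filterΣ⁺ irr {x ∷ _} p (there x∈)  | yes _ = there (∈-filterΣ⁺ irr p x∈)
  ∈-filterΣ⁺ irr {x ∷ _} p (here refl) | no ¬p = contradiction p ¬p
  ∈-filterΣ⁺ irr {x ∷ _} p (there x∈)  | no _  = ∈-filterΣ⁺ irr p x∈

  ∑-filterΣ : ∀ xs f → ∑ (filterΣ xs) (f ∘ proj₁) ≡ ∑ xs (λ x → 𝟙 (P? x) * f x)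
  ∑-filterΣ []       f = refl
  ∑-filterΣ (x ∷ xs) f with P? x
  ... | yes _ = cong₂ _+_ (sym (+-identityʳ (f x))) (∑-filterΣ xs f)
  ... | no _  = ∑-filterΣ xs f

∑-map : {A B : Set} (h : A → B) (xs : List A) (f : B → ℕ) → ∑ (map h xs) f ≡ ∑ xs (f ∘ h)
∑-map h []       f = refl
∑-map h (x ∷ xs) f = cong (f (h x) +_) (∑-map h xs f)

∑-cartesianProduct : {A B : Set} (xs : List A) (ys : List B) (f : A × B → ℕ) →
  ∑ (cartesianProduct xs ys) f ≡ ∑ xs (λ x → ∑ ys (λ y → f (x , y)))
∑-cartesianProduct []       ys f = refl
∑-cartesianProduct (x ∷ xs) ys f =
  trans (∑-++ (map (x ,_) ys) _ f) (cong₂ _+_ (∑-map (x ,_) ys f) (∑-cartesianProduct xs ys f))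

module _ {A : Set} (_≟ᴬ_ : DecidableEquality A) where

  open import Data.List.Membership.DecPropositional _≟ᴬ_ using (_∈?_)

  ∑-≟-≤1 : ∀ {xs} → Unique xs → ∀ y → ∑ xs (λ x → 𝟙 (x ≟ᴬ y)) ≤ 1
  ∑-≟-≤1 {xs} u y with y ∈? xs
  ... | yes y∈ = ≤-reflexive (trans (∑-single (λ x → 𝟙 (x ≟ᴬ y)) u y∈ (λ x → 𝟙-no (x ≟ᴬ y))) (𝟙-yes (y ≟ᴬ y) refl))
  ... | no y∉  = ≤-trans (≤-reflexive (∑-vanish xs (λ x → 𝟙 (x ≟ᴬ y)) λ {x} x∈ → 𝟙-no (x ≟ᴬ y) λ { refl → y∉ x∈ })) z≤n

  ∑-∈?-≤ : ∀ {xs} → Unique xs → ∀ ys → ∑ xs (λ x → 𝟙 (x ∈? ys)) ≤ length ys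
  ∑-∈?-≤ {xs} u ys = begin
    ∑ xs (λ x → 𝟙 (x ∈? ys))                ≤⟨ ∑-mono xs member ⟩
    ∑ xs (λ x → ∑ ys (λ y → 𝟙 (x ≟ᴬ y)))    ≡⟨ ∑-swap xs ys _ ⟩
    ∑ ys (λ y → ∑ xs (λ x → 𝟙 (x ≟ᴬ y)))    ≤⟨ ∑-mono ys (∑-≟-≤1 u) ⟩
    ∑ ys (λ _ → 1)                          ≡⟨ ∑-const ys 1 ⟩
    length ys * 1                           ≡⟨ *-identityʳ _ ⟩
    length ys                               ∎
    where
    open ≤-Reasoning
    member : ∀ x → 𝟙 (x ∈? ys) ≤ ∑ ys (λ y → 𝟙 (x ≟ᴬ y))
    member x with x ∈? ys
    ... | no _   = z≤n
    ... | yes x∈ = ≤-trans (≤-reflexive (sym (𝟙-yes (x ≟ᴬ x) refl))) (∑-member (λ y → 𝟙 (x ≟ᴬ y)) x∈)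

  unique-length≤ : ∀ {xs ys} → Unique xs → (∀ x → x ∈ ys) → length xs ≤ length ys
  unique-length≤ {xs} {ys} u complete = begin
    length xs                 ≡⟨ *-identityʳ _ ⟨
    length xs * 1             ≡⟨ ∑-const xs 1 ⟨
    ∑ xs (λ _ → 1)            ≡⟨ ∑-cong xs (λ x → sym (𝟙-yes (x ∈? ys) (complete x))) ⟩
    ∑ xs (λ x → 𝟙 (x ∈? ys))  ≤⟨ ∑-∈?-≤ u ys ⟩
    length ys                 ∎
    where open ≤-Reasoning

-- Line graphs

module LineGraph {n : ℕ} (G : Graph n) where

  src tgt : Edge G → Fin n
  src e = proj₁ (proj₁ e)
  tgt e = proj₂ (proj₁ e)

  open Graphic src tgt public

  IsEdge : Fin n × Fin n → Set
  IsEdge p = (proj₁ p F.< proj₂ p) × Adj G (proj₁ p) (proj₂ p)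

  isEdge? : ∀ p → Dec (IsEdge p)
  isEdge? p = (proj₁ p F.<? proj₂ p) ×-dec (adj G (proj₁ p) (proj₂ p) B.≟ true)

  isEdge-irrelevant : ∀ {p} (s t : IsEdge p) → s ≡ t
  isEdge-irrelevant (s , s') (t , t') = cong₂ _,_ (F.<-irrelevant s t) (uip s' t')
    where
    uip : ∀ {b c : B.Bool} (p q : b ≡ c) → p ≡ q
    uip refl refl = refl

  edge-≡ : ∀ {e f : Edge G} → proj₁ e ≡ proj₁ f → e ≡ f
  edge-≡ {p , s} {_ , t} refl = cong (p ,_) (isEdge-irrelevant s t)

  src≢tgt : ∀ e → src e ≢ tgt e
  src≢tgt (_ , lt , _) = F.<⇒≢ lt

  _≟ᴾ_ : DecidableEquality (Fin n × Fin n)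
  _≟ᴾ_ = ≡-dec _≟_ _≟_

  _≟ᴱ_ : DecidableEquality (Edge G)
  e ≟ᴱ f = map′ edge-≡ (cong proj₁) (proj₁ e ≟ᴾ proj₁ f)

  abstract
    allEdges : List (Edge G)
    allEdges = filterΣ isEdge? (cartesianProduct (allFin n) (allFin n))

    allEdges-unique : Unique allEdges
    allEdges-unique = filterΣ-unique isEdge? (Unique.cartesianProduct⁺ (Unique.allFin⁺ n) (Unique.allFin⁺ n))

    ∈-allEdges : ∀ e → e ∈ allEdges
    ∈-allEdges (p , s) = ∈-filterΣ⁺ isEdge? isEdge-irrelevant s (∈-cartesianProduct⁺ (∈-allFin _) (∈-allFin _))

    ∑-allEdges : ∀ f → ∑ allEdges (f ∘ proj₁) ≡
      ∑ (allFin n) (λ u → ∑ (allFin n) (λ v → 𝟙 (isEdge? (u , v)) * f (u , v)))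
    ∑-allEdges f = trans (∑-filterΣ isEdge? (cartesianProduct (allFin n) (allFin n)) f)
      (∑-cartesianProduct (allFin n) (allFin n) _)

  LineAdj? : ∀ e f → Dec (LineAdj G e f)
  LineAdj? e f = ¬? (proj₁ e ≟ᴾ proj₁ f) ×-dec
    ((src e ≟ src f) ⊎-dec ((src e ≟ tgt f) ⊎-dec ((tgt e ≟ src f) ⊎-dec (tgt e ≟ tgt f))))

  lineAdj : ∀ {x e f} → Incident x e → Incident x f → e ≢ f → LineAdj G e f
  lineAdj {e = e} {f} x∈e x∈f e≢f = e≢f ∘ edge-≡ , shared {e = e} {f} x∈e x∈f
    where
    shared : ∀ {x e f} → Incident x e → Incident x f →
      src e ≡ src f ⊎ src e ≡ tgt f ⊎ tgt e ≡ src f ⊎ tgt e ≡ tgt f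
    shared (inj₁ p) (inj₁ q) = inj₁ (trans (sym p) q)
    shared (inj₁ p) (inj₂ q) = inj₂ (inj₁ (trans (sym p) q))
    shared (inj₂ p) (inj₁ q) = inj₂ (inj₂ (inj₁ (trans (sym p) q)))
    shared (inj₂ p) (inj₂ q) = inj₂ (inj₂ (inj₂ (trans (sym p) q)))

  lineAdj⁻ : ∀ {e f} → LineAdj G e f → ∃ λ x → Incident x e × Incident x f
  lineAdj⁻ (_ , inj₁ p)               = _ , inj₁ refl , inj₁ p
  lineAdj⁻ (_ , inj₂ (inj₁ p))        = _ , inj₁ refl , inj₂ p
  lineAdj⁻ (_ , inj₂ (inj₂ (inj₁ p))) = _ , inj₂ refl , inj₁ p
  lineAdj⁻ (_ , inj₂ (inj₂ (inj₂ p))) = _ , inj₂ refl , inj₂ p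

  lineAdj-sym : ∀ {e f} → LineAdj G e f → LineAdj G f e
  lineAdj-sym {e} {f} ef@(e≢f , _) = let x , x∈e , x∈f = lineAdj⁻ {e} {f} ef in
    lineAdj {e = f} {e} x∈f x∈e (e≢f ∘ cong proj₁ ∘ sym)

  -- If every colour class contains a connected spanning subgraph and, in addition, an injective
  -- choice out i x of an edge at each vertex x, then an edge e of colour j ≠ i hangs on tree i at
  -- out i x for an end x of e. To avoid that two edges hang on each other, e = out j x uses
  -- the end x for j < i, and the other end for i < j.
  module FromColouring {k : ℕ} (χ : Edge G → Fin k) (v₀ : Fin n)
    (A : Fin k → List (Edge G)) (A-colour : ∀ i {e} → e ∈ A i → χ e ≡ i)
    (A-connected : ∀ i x y → label (A i) x ≡ label (A i) y)
    (out : Fin k → Fin n → Edge G) (out-colour : ∀ i x → χ (out i x) ≡ i)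
    (out-incident : ∀ i x → Incident x (out i x))
    (out-injective : ∀ i {x y} → out i x ≡ out i y → x ≡ y) where

    private
      InClass : Fin k → Edge G → Edge G → Set
      InClass i e f = LineAdj G e f × χ e ≡ i × χ f ≡ i

      hop : ∀ {i x e f g} → Incident x e → Incident x f → χ e ≡ i → χ f ≡ i →
        Walk (InClass i) f g → Walk (InClass i) e g
      hop {e = e} {f} x∈e x∈f ce cf w with e ≟ᴱ f
      ... | yes refl = w
      ... | no e≢f   = step (lineAdj x∈e x∈f e≢f , ce , cf) w

      line-walk : ∀ {i x y e f} → Walk (Via (A i)) x y → Incident x e → Incident y f → χ e ≡ i → χ f ≡ i →
        Walk (InClass i) e f
      line-walk here x∈e y∈f ce cf = hop x∈e y∈f ce cf here
      line-walk {i} (step (g , g∈ , inj₁ (refl , refl)) w) x∈e y∈f ce cf =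
        hop x∈e (inj₁ refl) ce (A-colour i g∈) (line-walk w (inj₂ refl) y∈f (A-colour i g∈) cf)
      line-walk {i} (step (g , g∈ , inj₂ (refl , refl)) w) x∈e y∈f ce cf =
        hop x∈e (inj₂ refl) ce (A-colour i g∈) (line-walk w (inj₁ refl) y∈f (A-colour i g∈) cf)

      record Ends (e : Edge G) : Set where
        field
          owner other : Fin n
          owner-incident : Incident owner e
          other-incident : Incident other e
          owned : ∀ {x} → out (χ e) x ≡ e → owner ≡ x × owner ≢ other
      open Ends

      ends : ∀ e → Ends e
      ends e with out (χ e) (src e) ≟ᴱ e | out (χ e) (tgt e) ≟ᴱ e
      ... | yes p | _ = record
        { owner = src e ; other = tgt e ; owner-incident = inj₁ refl ; other-incident = inj₂ refl
        ; owned = λ q → out-injective (χ e) (trans p (sym q)) , src≢tgt e }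
      ... | no _ | yes p = record
        { owner = tgt e ; other = src e ; owner-incident = inj₂ refl ; other-incident = inj₁ refl
        ; owned = λ q → out-injective (χ e) (trans p (sym q)) , src≢tgt e ∘ sym }
      -- No vertex has chosen `e`, so nothing can hang on it from another class and one end serves
      -- both purposes.
      ... | no ¬p | no ¬q = record
        { owner = src e ; other = src e ; owner-incident = inj₁ refl ; other-incident = inj₁ refl
        ; owned = λ {x} q → contradiction q (λ q → [ (λ { refl → ¬p q }) , (λ { refl → ¬q q }) ]′
            (subst (Incident x) q (out-incident (χ e) x))) }

      end : Fin k → Edge G → Fin n
      end i e with χ e F.<? i
      ... | yes _ = owner (ends e)
      ... | no _  = other (ends e)

      end-incident : ∀ i e → Incident (end i e) e
      end-incident i e with χ e F.<? i
      ... | yes _ = owner-incident (ends e)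
      ... | no _  = other-incident (ends e)

      end-< : ∀ {i} e → χ e F.< i → end i e ≡ owner (ends e)
      end-< {i} e lt with χ e F.<? i
      ... | yes _ = refl
      ... | no ge = contradiction lt ge

      end-> : ∀ {i} e → i F.< χ e → end i e ≡ other (ends e)
      end-> {i} e gt with χ e F.<? i
      ... | yes lt = contradiction lt (F.<-asym gt)
      ... | no _   = refl

      attach : Fin k → Edge G → Edge G
      attach i e = out i (end i e)

      -- Since `b` has the smaller colour, it hangs by its owner, and `a` by its other end. Mutual
      -- attachment would give owner of `a` = owner of `b` = other end of `a`.
      no-2-cycle : ∀ a b → χ b F.< χ a → attach (χ a) b ≡ a → attach (χ b) a ≡ b → ⊥
      no-2-cycle a b lt p q rewrite end-< b lt | end-> a lt =
        let a-owner , a-proper = owned (ends a) p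
            b-owner , _ = owned (ends b) q
        in a-proper (trans a-owner b-owner)

      attach-antisym : ∀ {i j a b} → i ≢ j → χ a ≡ i → χ b ≡ j → attach i b ≡ a → attach j a ≡ b → ⊥
      attach-antisym {i} {j} {a} {b} i≢j refl refl p q with F.<-cmp i j
      ... | tri< lt _ _ = no-2-cycle b a lt q p
      ... | tri≈ _ eq _ = i≢j eq
      ... | tri> _ _ gt = no-2-cycle a b gt p q

    cists : HasCISTs (LineAdj G) k
    cists = partition⇒CISTs _≟ᴱ_ allEdges ∈-allEdges LineAdj? (λ {e} {f} → lineAdj-sym {e} {f}) χ (λ i → out i v₀)
      (λ {i} {e} ce → line-walk (connected-walk {A i} (A-connected i) v₀ (src e))
        (out-incident i v₀) (inj₁ refl) (out-colour i v₀) ce)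
      attach (λ {i} {e} _ → out-colour i (end i e))
      (λ {i} {e} ce → lineAdj (end-incident i e) (out-incident i (end i e)) λ e≡ → ce (trans (cong χ e≡) (out-colour i _)))
      attach-antisym

-- From colour classes of full rank to spanning trees of the line graph

lookup-unique : {A : Set} {xs : List A} → Unique xs → ∀ i j → lookup xs i ≡ lookup xs j → i ≡ j
lookup-unique (_ ∷ _)  F.zero    F.zero    _  = refl
lookup-unique (x∉ ∷ _) F.zero    (F.suc j) eq = contradiction eq (All.lookup x∉ (∈-lookup j))
lookup-unique (x∉ ∷ _) (F.suc i) F.zero    eq = contradiction (sym eq) (All.lookup x∉ (∈-lookup i))
lookup-unique (_ ∷ u)  (F.suc i) (F.suc j) eq = cong F.suc (lookup-unique u i j eq)

module Packing {n r : ℕ} (n≡1+r : n ≡ suc r) (v₀ : Fin n) (G : Graph n) {k : ℕ} where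

  open LineGraph G
  open Colouring _≟ᴱ_ allEdges allEdges-unique ∈-allEdges {k}
  open import Data.List.Membership.DecPropositional _≟ᴱ_ using (_∈?_)

  rank≤r : ∀ A → rank A ≤ r
  rank≤r A = ≤-pred (begin
    suc (rank A)                   ≡⟨ +-comm 1 (rank A) ⟩
    rank A + 1                     ≤⟨ +-monoʳ-≤ (rank A) (components≥1 v₀ A) ⟩
    rank A + components (label A)  ≡⟨ trans (rank+components A) n≡1+r ⟩
    suc r                          ∎)
    where open ≤-Reasoning

  module _ (χ : Edge G → Fin k) (full : ∀ i → rank (class χ i) ≡ r) (enough : k * n ≤ length allEdges) where

    private
      A : Fin k → List (Edge G)
      A i = basis (class χ i)

      A-colour : ∀ i {e} → e ∈ A i → χ e ≡ i
      A-colour i e∈ = ∈-class⁻ (basis⊆ (class χ i) e∈)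

      A-connected : ∀ i x y → label (A i) x ≡ label (A i) y
      A-connected i x y = label-coarsen {class χ i} {A i} (basis-spans (class χ i))
        (components≡1⇒connected (class χ i) (+-cancelˡ-≡ r _ 1 (begin
          r + components (label (class χ i))                   ≡⟨ cong (_+ components (label (class χ i))) (full i) ⟨
          rank (class χ i) + components (label (class χ i))    ≡⟨ rank+components (class χ i) ⟩
          n                                                    ≡⟨ n≡1+r ⟩
          suc r                                                ≡⟨ +-comm 1 r ⟩
          r + 1                                                ∎)) x y)
        where open ≡-Reasoning

      extra? : ∀ e → Dec (e ∉ A (χ e))
      extra? e = ¬? (e ∈? A (χ e))

      extras : List (Edge G)
      extras = filter extra? allEdges

      -- The bases use only `k * r = k * (n - 1)` of at least `k * n` edges.
      length-extras : k ≤ length extras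
      length-extras = +-cancelʳ-≤ (k * r) k _ (begin
        k + k * r                    ≡⟨ *-suc k r ⟨
        k * suc r                    ≡⟨ cong (k *_) n≡1+r ⟨
        k * n                        ≤⟨ enough ⟩
        length allEdges              ≡⟨ trans (∑-const allEdges 1) (*-identityʳ _) ⟨
        ∑ allEdges (λ _ → 1)         ≤⟨ ∑-mono allEdges covered ⟩
        ∑ allEdges (λ e → 𝟙 (extra? e) + ∑ (allFin k) (λ i → 𝟙 (e ∈? A i)))
                                     ≡⟨ ∑-+ allEdges _ _ ⟩
        ∑ allEdges (𝟙 ∘ extra?) + ∑ allEdges (λ e → ∑ (allFin k) (λ i → 𝟙 (e ∈? A i)))
          ≡⟨ cong₂ _+_ (sym (length-filter-∑ extra? allEdges)) (∑-swap allEdges (allFin k) _) ⟩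
        length extras + ∑ (allFin k) (λ i → ∑ allEdges (λ e → 𝟙 (e ∈? A i)))
          ≤⟨ +-monoʳ-≤ (length extras) (∑-mono (allFin k) (λ i → ∑-∈?-≤ _≟ᴱ_ allEdges-unique (A i))) ⟩
        length extras + ∑ (allFin k) (λ i → length (A i))
          ≡⟨ cong (length extras +_) (trans (∑-cong (allFin k) (λ i → trans (length-basis (class χ i)) (full i)))
                                            (∑-allFin-const k r)) ⟩
        length extras + k * r        ∎)
        where
        open ≤-Reasoning
        covered : ∀ e → 1 ≤ 𝟙 (extra? e) + ∑ (allFin k) (λ i → 𝟙 (e ∈? A i))
        covered e with e ∈? A (χ e)
        ... | no _   = s≤s z≤n
        ... | yes e∈ = ≤-trans (≤-reflexive (sym (𝟙-yes (e ∈? A (χ e)) e∈)))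
                               (∑-member (λ i → 𝟙 (e ∈? A i)) (∈-allFin (χ e)))

      abstract
        extra : Fin k → Edge G
        extra i = lookup extras (inject≤ i length-extras)

        extra-injective : ∀ {i j} → extra i ≡ extra j → i ≡ j
        extra-injective eq = F.inject≤-injective length-extras length-extras _ _
          (lookup-unique (Unique.filter⁺ extra? allEdges-unique) _ _ eq)

        extra∉ : ∀ i j → extra i ∉ A j
        extra∉ i j e∈ = proj₂ (∈-filter⁻ extra? {xs = allEdges} (∈-lookup (inject≤ i length-extras)))
          (subst (λ c → extra i ∈ A c) (sym (A-colour j e∈)) e∈)

      -- The `i`-th extra edge moves to class `i`, whatever its colour was. The extra edges avoid
      -- all bases, so the bases keep their colours.
      χ' : Edge G → Fin k
      χ' e with F.any? (λ i → extra i ≟ᴱ e)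
      ... | yes (i , _) = i
      ... | no _        = χ e

      χ'-extra : ∀ i → χ' (extra i) ≡ i
      χ'-extra i with F.any? (λ j → extra j ≟ᴱ extra i)
      ... | yes (j , eq) = extra-injective eq
      ... | no none      = contradiction (i , refl) none

      χ'-A : ∀ i {e} → e ∈ A i → χ' e ≡ i
      χ'-A i {e} e∈ with F.any? (λ j → extra j ≟ᴱ e)
      ... | yes (j , refl) = contradiction e∈ (extra∉ j i)
      ... | no _           = A-colour i e∈

      orientation = λ i → unicyclic-orientation
        (basis-unique (Unique.filter⁺ (λ e → χ e ≟ i) allEdges-unique)) (extra∉ i i) (A-connected i)

      out-colour : ∀ i {e} → e ∈ extra i ∷ A i → χ' e ≡ i
      out-colour i (here refl) = χ'-extra i
      out-colour i (there e∈)  = χ'-A i e∈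

    full-classes⇒CISTs : HasCISTs (LineAdj G) k
    full-classes⇒CISTs = FromColouring.cists χ' v₀ A χ'-A A-connected (λ i → proj₁ (orientation i))
      (λ i x → out-colour i (proj₁ (proj₁ (proj₂ (orientation i)) x)))
      (λ i x → proj₂ (proj₁ (proj₂ (orientation i)) x))
      (λ i → proj₂ (proj₂ (orientation i)))

  packing⇒CISTs : Fin k → k * n ≤ length allEdges →
    (∀ R → k * r ≤ ∑ allEdges (λ e → 𝟙 (¬? (e ∈? R))) + k * rank R) → HasCISTs (LineAdj G) k
  packing⇒CISTs i enough cuts =
    let χ , full = base-packing r rank≤r cuts (λ _ → i) in full-classes⇒CISTs χ full enough

-- Arithmetic of the weights

≤-ceilDiv* : ∀ a b → 0 < b → a ≤ ceilDiv a b * b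
≤-ceilDiv* a (suc t) _ = +-cancelʳ-≤ t a _ (begin
  a + t                                    ≡⟨ m≡m%n+[m/n]*n (a + t) (suc t) ⟩
  (a + t) % suc t + (a + t) / suc t * suc t ≤⟨ +-monoˡ-≤ _ (≤-pred (m%n<n (a + t) (suc t))) ⟩
  t + (a + t) / suc t * suc t              ≡⟨ +-comm t _ ⟩
  (a + t) / suc t * suc t + t              ∎)
  where open ≤-Reasoning

module Weights {k d c : ℕ} (c+k≡d : c + k ≡ d) (c<k : c < k) where

  -- A block with b boundary edges takes the share g b / d² of each of them: the function
  -- 1 − b (d − k) / d² is the chord of k / b between its values at b = d and b = d k / (d − k),
  -- and it is continued by a constant.
  g : ℕ → ℕ
  g b = (d * d ∸ b * c) ⊔ d * c

  private
    2c≤d : c + c ≤ d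
    2c≤d = ≤-trans (+-monoʳ-≤ c (<⇒≤ c<k)) (≤-reflexive c+k≡d)

    c≤d : c ≤ d
    c≤d = ≤-trans (m≤m+n c c) 2c≤d

    chord+flat : ∀ {b} → d ≤ b → (d * d ∸ b * c) + d * c ≤ d * d
    chord+flat {b} d≤b = begin
      (d * d ∸ b * c) + d * c ≤⟨ +-monoˡ-≤ (d * c) (∸-monoʳ-≤ (d * d) (*-monoˡ-≤ c d≤b)) ⟩
      (d * d ∸ d * c) + d * c ≡⟨ m∸n+n≡m (*-monoʳ-≤ d c≤d) ⟩
      d * d                   ∎
      where open ≤-Reasoning

    chord+chord : ∀ D X Y → D ≤ X + Y → (D ∸ X) + (D ∸ Y) ≤ D
    chord+chord D X Y D≤ with ≤-total Y D
    ... | inj₁ Y≤D = begin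
      (D ∸ X) + (D ∸ Y)  ≤⟨ +-monoˡ-≤ (D ∸ Y) (m≤n+o⇒m∸n≤o D X D≤) ⟩
      Y + (D ∸ Y)        ≡⟨ m+[n∸m]≡n Y≤D ⟩
      D                  ∎
      where open ≤-Reasoning
    ... | inj₂ D≤Y = begin
      (D ∸ X) + (D ∸ Y)  ≡⟨ cong (D ∸ X +_) (m≤n⇒m∸n≡0 D≤Y) ⟩
      (D ∸ X) + 0        ≡⟨ +-identityʳ _ ⟩
      D ∸ X              ≤⟨ m∸n≤m D X ⟩
      D                  ∎
      where open ≤-Reasoning

  -- Divided by d²: two chord values sum to 2 - (b + b')c/d² ≤ 1; a chord value is at most k/d, and
  -- k/d + c/d = 1; two constants give 2c/d ≤ 1 because c < k.
  g-shares : ∀ {b b'} → d ≤ b → d ≤ b' → d * d ≤ (b + b') * c → g b + g b' ≤ d * d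
  g-shares {b} {b'} d≤b d≤b' D≤
    with ⊔-sel (d * d ∸ b * c) (d * c) | ⊔-sel (d * d ∸ b' * c) (d * c)
  ... | inj₁ p | inj₁ q rewrite p | q =
    chord+chord (d * d) (b * c) (b' * c) (≤-trans D≤ (≤-reflexive (*-distribʳ-+ c b b')))
  ... | inj₁ p | inj₂ q rewrite p | q = chord+flat d≤b
  ... | inj₂ p | inj₁ q rewrite p | q = ≤-trans (≤-reflexive (+-comm (d * c) _)) (chord+flat d≤b')
  ... | inj₂ p | inj₂ q rewrite p | q =
    ≤-trans (≤-reflexive (sym (*-distribˡ-+ d c c))) (*-monoʳ-≤ d 2c≤d)

  g-mass : ∀ {b} → d ≤ b → k * (d * d) ≤ b * g b
  g-mass {b} d≤b with ≤-total (d * k) (b * c)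
  ... | inj₁ dk≤bc = begin
    k * (d * d)        ≡⟨ rearrange k d ⟩
    d * (d * k)        ≤⟨ *-monoʳ-≤ d dk≤bc ⟩
    d * (b * c)        ≡⟨ exchange d b c ⟩
    b * (d * c)        ≤⟨ *-monoʳ-≤ b (m≤n⊔m (d * d ∸ b * c) (d * c)) ⟩
    b * g b            ∎
    where
    open ≤-Reasoning
    rearrange : ∀ k d → k * (d * d) ≡ d * (d * k)
    rearrange = solve-∀
    exchange : ∀ d b c → d * (b * c) ≡ b * (d * c)
    exchange = solve-∀
  ... | inj₂ bc≤dk with s , refl ← m≤n⇒∃[o]m+o≡n d≤b = begin
    k * (d * d)                                ≤⟨ m+n≤o⇒m≤o∸n _ key ⟩
    b * (d * d) ∸ b * (b * c)                  ≡⟨ *-distribˡ-∸ b (d * d) (b * c) ⟨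
    b * (d * d ∸ b * c)                        ≤⟨ *-monoʳ-≤ b (m≤m⊔n (d * d ∸ b * c) (d * c)) ⟩
    b * g b                                    ∎
    where
    open ≤-Reasoning
    expand : ∀ k d s c → k * (d * d) + (d + s) * ((d + s) * c) ≡ d * (d * k) + d * ((d + s) * c) + s * ((d + s) * c)
    expand = solve-∀
    collect : ∀ k d s c → d * (d * k) + d * ((d + s) * c) + s * (d * k) ≡ (d + s) * (d * (c + k))
    collect = solve-∀
    -- The right side minus the left side is (b - d)(dk - bc), a product of two nonnegative factors;
    -- here `s` is b - d.
    key : k * (d * d) + b * (b * c) ≤ b * (d * d)
    key = begin
      k * (d * d) + b * (b * c)                      ≡⟨ expand k d s c ⟩
      d * (d * k) + d * (b * c) + s * (b * c)        ≤⟨ +-monoʳ-≤ (d * (d * k) + d * (b * c)) (*-monoʳ-≤ s bc≤dk) ⟩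
      d * (d * k) + d * (b * c) + s * (d * k)        ≡⟨ collect k d s c ⟩
      b * (d * (c + k))                              ≡⟨ cong (λ t → b * (d * t)) c+k≡d ⟩
      b * (d * d)                                    ∎

  -- Otherwise (2 + m)c ≤ (d + 1)c < d(c + 1) ≤ d². Hence a boundary of size at least `m` is also
  -- one of size at least `d`.
  d≤m : 0 < k → ∀ {m} → d * d ≤ (2 + m) * c → d ≤ m
  d≤m 0<k {m} D≤ = ≮⇒≥ λ m<d → <-irrefl refl (begin-strict
    d * d            ≤⟨ D≤ ⟩
    (2 + m) * c      ≤⟨ *-monoˡ-≤ c (s≤s m<d) ⟩
    c + d * c        <⟨ +-monoˡ-< (d * c) c<d ⟩
    d + d * c        ≡⟨ *-suc d c ⟨
    d * suc c        ≤⟨ *-monoʳ-≤ d c<d ⟩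
    d * d            ∎)
    where
    open ≤-Reasoning
    c<d : c < d
    c<d = subst (c <_) c+k≡d (m<m+n c 0<k)

-- Counting edges

module Counting {n : ℕ} (G : Graph n) where

  open LineGraph G

  ∑ⱽ : (Fin n → ℕ) → ℕ
  ∑ⱽ = ∑ (allFin n)

  adj? : ∀ u v → Dec (Adj G u v)
  adj? u v = adj G u v B.≟ true

  adj-flip : ∀ {u v} → Adj G u v → Adj G v u
  adj-flip {u} {v} uv = trans (adj-sym G v u) uv

  adj-irrefl : ∀ {v} → ¬ Adj G v v
  adj-irrefl {v} vv with () ← trans (sym vv) (irrefl G v)

  joining-edge : ∀ {u v} → Adj G u v → ∃ λ e → Joins e u v
  joining-edge {u} {v} uv with F.<-cmp u v
  ... | tri< lt _ _   = ((u , v) , lt , uv) , inj₁ (refl , refl)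
  ... | tri≈ _ refl _ = contradiction uv adj-irrefl
  ... | tri> _ _ gt   = ((v , u) , gt , adj-flip uv) , inj₂ (refl , refl)

  -- An edge is stored once, with its smaller end first, but occurs as two ordered adjacent pairs.
  -- `F` may be asymmetric, so degrees, boundaries and shares are all covered.
  handshake : ∀ (F : Fin n → Fin n → ℕ) → ∑ⱽ (λ u → ∑ⱽ (λ v → 𝟙 (adj? u v) * F u v)) ≡ ∑ allEdges (λ e → F (src e) (tgt e) + F (tgt e) (src e))
  handshake F = begin
    ∑ⱽ (λ u → ∑ⱽ (λ v → 𝟙 (adj? u v) * F u v))
      ≡⟨ ∑-cong (allFin n) (λ u → trans (∑-cong (allFin n) (λ v → trans (cong (_* F u v) (orient u v)) (*-distribʳ-+ (F u v) (edge u v) _)))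
                               (∑-+ (allFin n) (λ v → edge u v * F u v) _)) ⟩
    ∑ⱽ (λ u → ∑ⱽ (λ v → edge u v * F u v) + ∑ⱽ (λ v → edge v u * F u v))
      ≡⟨ ∑-+ (allFin n) (λ u → ∑ⱽ (λ v → edge u v * F u v)) _ ⟩
    ∑ⱽ (λ u → ∑ⱽ (λ v → edge u v * F u v)) + ∑ⱽ (λ u → ∑ⱽ (λ v → edge v u * F u v))
      ≡⟨ cong (∑ⱽ (λ u → ∑ⱽ (λ v → edge u v * F u v)) +_) (∑-swap (allFin n) (allFin n) _) ⟩
    ∑ⱽ (λ u → ∑ⱽ (λ v → edge u v * F u v)) + ∑ⱽ (λ u → ∑ⱽ (λ v → edge u v * F v u))
      ≡⟨ ∑-+ (allFin n) (λ u → ∑ⱽ (λ v → edge u v * F u v)) _ ⟨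
    ∑ⱽ (λ u → ∑ⱽ (λ v → edge u v * F u v) + ∑ⱽ (λ v → edge u v * F v u))
      ≡⟨ ∑-cong (allFin n) (λ u → trans (sym (∑-+ (allFin n) (λ v → edge u v * F u v) _))
                               (∑-cong (allFin n) (λ v → sym (*-distribˡ-+ (edge u v) (F u v) _)))) ⟩
    ∑ⱽ (λ u → ∑ⱽ (λ v → edge u v * (F u v + F v u)))
      ≡⟨ ∑-allEdges (λ (u , v) → F u v + F v u) ⟨
    ∑ allEdges (λ e → F (src e) (tgt e) + F (tgt e) (src e)) ∎
    where
    open ≡-Reasoning
    edge : Fin n → Fin n → ℕ
    edge u v = 𝟙 (isEdge? (u , v))
    orient : ∀ u v → 𝟙 (adj? u v) ≡ edge u v + edge v u
    orient u v with F.<-cmp u v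
    ... | tri< lt _ ≯ = trans (𝟙-cong (adj? u v) (isEdge? (u , v)) (lt ,_) proj₂)
      (trans (sym (+-identityʳ _)) (cong (edge u v +_) (sym (𝟙-no (isEdge? (v , u)) (≯ ∘ proj₁)))))
    ... | tri≈ ≮ refl _ = trans (𝟙-no (adj? u u) adj-irrefl)
      (sym (cong₂ _+_ (𝟙-no (isEdge? (u , u)) (≮ ∘ proj₁)) (𝟙-no (isEdge? (u , u)) (≮ ∘ proj₁))))
    ... | tri> ≮ _ gt = trans (𝟙-cong (adj? u v) (isEdge? (v , u)) (λ uv → gt , adj-flip uv) (adj-flip ∘ proj₂))
      (cong (_+ edge v u) (sym (𝟙-no (isEdge? (u , v)) (≮ ∘ proj₁))))

  degree-∑ : ∀ v → degree G v ≡ ∑ⱽ (λ u → 𝟙 (adj? v u))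
  degree-∑ v = trans (length-filter-∑ (λ u → B.T? (adj G v u)) (allFin n))
    (∑-cong (allFin n) (λ u → 𝟙-cong (B.T? (adj G v u)) (adj? v u) (Equivalence.to T-≡) (Equivalence.from T-≡)))

  degree-edges : ∀ x → degree G x ≡ ∑ allEdges (λ e → 𝟙 (src e ≟ x) + 𝟙 (tgt e ≟ x))
  degree-edges x = begin
    degree G x                                          ≡⟨ degree-∑ x ⟩
    ∑ⱽ (λ v → 𝟙 (adj? x v))                             ≡⟨ ∑-cong (allFin n) (λ v → at-x v) ⟨
    ∑ⱽ (λ v → 𝟙 (adj? x v) * 𝟙 (x ≟ x))                 ≡⟨ ∑-single row (Unique.allFin⁺ n) (∈-allFin x) off-x ⟨
    ∑ⱽ (λ u → ∑ⱽ (λ v → 𝟙 (adj? u v) * 𝟙 (u ≟ x)))      ≡⟨ handshake (λ u _ → 𝟙 (u ≟ x)) ⟩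
    ∑ allEdges (λ e → 𝟙 (src e ≟ x) + 𝟙 (tgt e ≟ x))    ∎
    where
    open ≡-Reasoning
    row : Fin n → ℕ
    row u = ∑ⱽ (λ v → 𝟙 (adj? u v) * 𝟙 (u ≟ x))
    at-x : ∀ v → 𝟙 (adj? x v) * 𝟙 (x ≟ x) ≡ 𝟙 (adj? x v)
    at-x v = trans (cong (𝟙 (adj? x v) *_) (𝟙-yes (x ≟ x) refl)) (*-identityʳ _)
    off-x : ∀ u → u ≢ x → row u ≡ 0
    off-x u u≢x = trans (∑-cong (allFin n) (λ v → trans (cong (𝟙 (adj? u v) *_) (𝟙-no (u ≟ x) u≢x)) (*-zeroʳ (𝟙 (adj? u v)))))
                        (∑-zero (allFin n))

  -- Consequences of the connectivity of the line graph

  module Cuts {m : ℕ} (m-connected : MConnected (LineAdj G) m) where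

    -- A walk in L(G) that starts in `C` can leave it only through `S`, so fewer than `m` members of
    -- `S` would contradict connectivity.
    separator : {C : Edge G → Set} (S : List (Edge G)) →
      (∀ {e f} → C e → LineAdj G e f → f ∉ S → C f) →
      ∀ {a b} → a ∉ S → C a → b ∉ S → ¬ C b → m ≤ length S
    separator {C} S closed {a} {b} a∉ Ca b∉ ¬Cb = ≮⇒≥ λ lt →
      let w , avoids = proj₂ m-connected S lt a b a∉ b∉ in ¬Cb (follow w avoids Ca)
      where
      follow : ∀ {a b} (w : Walk (LineAdj G) a b) → (∀ x → x ∈ verts w → x ∉ S) → C a → C b
      follow here avoids Ca = Ca
      follow (step ae w) avoids Ca =
        follow w (λ x x∈ → avoids x (there x∈)) (closed Ca ae (avoids _ (there (first∈verts w))))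

    private
      -- The neighbours of `e` separate it from any non-neighbour; if there is none, they are all
      -- the other vertices of L(G), of which there are at least `m`.
      line-degree : ∀ e → m ≤ length (filter (LineAdj? e) allEdges)
      line-degree e with any? (λ f → ¬? (f ≟ᴱ e) ×-dec ¬? (LineAdj? e f)) allEdges
      ... | yes some = let f , _ , f≢e , ¬adj = find some in
        separator {λ f → f ≡ e} S (λ { refl ef f∉ → contradiction (∈-filter⁺ (LineAdj? e) (∈-allEdges _) ef) f∉ })
          (λ e∈ → proj₁ (inS e∈) refl) refl (¬adj ∘ inS) f≢e
        where
        S = filter (LineAdj? e) allEdges
        inS : ∀ {f} → f ∈ S → LineAdj G e f
        inS f∈ = proj₂ (∈-filter⁻ (LineAdj? e) {xs = allEdges} f∈)
      ... | no none = ≤-pred (≤-trans (proj₂ (proj₂ (proj₁ m-connected)))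
        (unique-length≤ _≟ᴱ_ (proj₁ (proj₂ (proj₁ m-connected))) all-close))
        where
        all-close : ∀ f → f ∈ e ∷ filter (LineAdj? e) allEdges
        all-close f with f ≟ᴱ e | LineAdj? e f
        ... | yes f≡e | _      = here f≡e
        ... | no _    | yes ef = there (∈-filter⁺ (LineAdj? e) (∈-allEdges f) ef)
        ... | no f≢e  | no ¬ef = contradiction (lose (∈-allEdges f) (f≢e , ¬ef)) none

      -- The degrees of the two ends count every neighbour of `e` in L(G) and count `e` itself
      -- twice, whence the 2.
      edge-degree-sum : ∀ e → 2 + m ≤ degree G (src e) + degree G (tgt e)
      edge-degree-sum e = begin
        2 + m                                                            ≤⟨ +-monoʳ-≤ 2 (line-degree e) ⟩
        2 + length (filter (LineAdj? e) allEdges)                        ≡⟨ cong₂ _+_ (sym twice) (length-filter-∑ (LineAdj? e) allEdges) ⟩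
        ∑ allEdges (λ f → 2 * 𝟙 (f ≟ᴱ e)) + ∑ allEdges (𝟙 ∘ LineAdj? e)  ≡⟨ ∑-+ allEdges _ _ ⟨
        ∑ allEdges (λ f → 2 * 𝟙 (f ≟ᴱ e) + 𝟙 (LineAdj? e f))             ≤⟨ ∑-mono allEdges ends ⟩
        ∑ allEdges (λ f → at (src e) f + at (tgt e) f)                   ≡⟨ ∑-+ allEdges (at (src e)) (at (tgt e)) ⟩
        ∑ allEdges (at (src e)) + ∑ allEdges (at (tgt e))                ≡⟨ cong₂ _+_ (degree-edges (src e)) (degree-edges (tgt e)) ⟨
        degree G (src e) + degree G (tgt e)                              ∎
        where
        open ≤-Reasoning
        at : Fin n → Edge G → ℕ
        at x f = 𝟙 (src f ≟ x) + 𝟙 (tgt f ≟ x)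
        twice : ∑ allEdges (λ f → 2 * 𝟙 (f ≟ᴱ e)) ≡ 2
        twice = trans (∑-single (λ f → 2 * 𝟙 (f ≟ᴱ e)) allEdges-unique (∈-allEdges e)
                        (λ f f≢e → cong (2 *_) (𝟙-no (f ≟ᴱ e) f≢e)))
                      (cong (2 *_) (𝟙-yes (e ≟ᴱ e) refl))
        at-incident : ∀ {x f} → Incident x f → 1 ≤ at x f
        at-incident {x} {f} (inj₁ p) = ≤-trans (≤-reflexive (sym (𝟙-yes (src f ≟ x) (sym p)))) (m≤m+n _ _)
        at-incident {x} {f} (inj₂ p) = ≤-trans (≤-reflexive (sym (𝟙-yes (tgt f ≟ x) (sym p)))) (m≤n+m _ _)
        ends : ∀ f → 2 * 𝟙 (f ≟ᴱ e) + 𝟙 (LineAdj? e f) ≤ at (src e) f + at (tgt e) f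
        ends f with f ≟ᴱ e
        ... | yes refl = ≤-trans (≤-reflexive (cong (2 +_) (𝟙-no (LineAdj? e e) (λ ee → proj₁ ee refl))))
          (+-mono-≤ (at-incident {f = e} (inj₁ refl)) (at-incident {f = e} (inj₂ refl)))
        ... | no _ with LineAdj? e f
        ...   | no _   = z≤n
        ...   | yes ef with lineAdj⁻ {e} {f} ef
        ...     | _ , inj₁ refl , x∈f = ≤-trans (at-incident {f = f} x∈f) (m≤m+n (at (src e) f) _)
        ...     | _ , inj₂ refl , x∈f = ≤-trans (at-incident {f = f} x∈f) (m≤n+m _ (at (src e) f))

    degree-sum : ∀ {x y} → Adj G x y → 2 + m ≤ degree G x + degree G y
    degree-sum {x} {y} xy with joining-edge xy
    ... | e , inj₁ (refl , refl) = edge-degree-sum e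
    ... | e , inj₂ (refl , refl) = ≤-trans (edge-degree-sum e) (≤-reflexive (+-comm (degree G (src e)) _))

  -- Boundaries of blocks and crossing edges

  module Blocks (ℓ : Fin n → Fin n) where

    Leaves : Fin n → Fin n → Fin n → Set
    Leaves r u v = ℓ u ≡ r × ℓ v ≢ r

    leaves? : ∀ r u v → Dec (Leaves r u v)
    leaves? r u v = (ℓ u ≟ r) ×-dec ¬? (ℓ v ≟ r)

    boundary : Fin n → ℕ
    boundary r = ∑ⱽ (λ u → ∑ⱽ (λ v → 𝟙 (adj? u v) * 𝟙 (leaves? r u v)))

    crosses? : ∀ e → Dec (ℓ (src e) ≢ ℓ (tgt e))
    crosses? e = ¬? (ℓ (src e) ≟ ℓ (tgt e))

    crossing : ℕ
    crossing = ∑ allEdges (𝟙 ∘ crosses?)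

    Inside Outside : Fin n → Edge G → Set
    Inside  r e = ℓ (src e) ≡ r × ℓ (tgt e) ≡ r
    Outside r e = ℓ (src e) ≢ r × ℓ (tgt e) ≢ r

    inside? : ∀ r e → Dec (Inside r e)
    inside? r e = (ℓ (src e) ≟ r) ×-dec (ℓ (tgt e) ≟ r)

    outside? : ∀ r e → Dec (Outside r e)
    outside? r e = ¬? (ℓ (src e) ≟ r) ×-dec ¬? (ℓ (tgt e) ≟ r)

    edgeless⇒degree≤boundary : ∀ {r} → (∀ e → ¬ Inside r e) → ∀ u → ℓ u ≡ r → degree G u ≤ boundary r
    edgeless⇒degree≤boundary {r} none u ℓu≡r = begin
      degree G u                                       ≡⟨ degree-∑ u ⟩
      ∑ⱽ (λ v → 𝟙 (adj? u v))                          ≤⟨ ∑-mono (allFin n) leaving ⟩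
      ∑ⱽ (λ v → 𝟙 (adj? u v) * 𝟙 (leaves? r u v))      ≤⟨ ∑-member (λ u → ∑ⱽ (λ v → 𝟙 (adj? u v) * 𝟙 (leaves? r u v))) (∈-allFin u) ⟩
      boundary r                                       ∎
      where
      open ≤-Reasoning
      leaving : ∀ v → 𝟙 (adj? u v) ≤ 𝟙 (adj? u v) * 𝟙 (leaves? r u v)
      leaving v with adj? u v
      ... | no _ = z≤n
      ... | yes uv = ≤-reflexive (sym (trans (+-identityʳ _) (𝟙-yes (leaves? r u v) (ℓu≡r , λ ℓv≡r → inner ℓv≡r (joining-edge uv)))))
        where
        inner : ℓ v ≡ r → ¬ ∃ λ e → Joins e u v
        inner ℓv≡r (e , inj₁ (refl , refl)) = none e (ℓu≡r , ℓv≡r)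
        inner ℓv≡r (e , inj₂ (refl , refl)) = none e (ℓv≡r , ℓu≡r)

  -- Lower bounds for the number of crossing edges

  module Bound {k d c m : ℕ} (c+k≡d : c + k ≡ d) (c<k : c < k) (2≤d : 2 ≤ d) (d²≤[2+m]c : d * d ≤ (2 + m) * c)
    (min-degree : ∀ v → d ≤ degree G v) (m-connected : MConnected (LineAdj G) m) (ℓ : Fin n → Fin n) where

    open Cuts m-connected
    open Blocks ℓ
    open Weights c+k≡d c<k

    -- The two sources of a large boundary: a block without inner edges sends out all edges at each
    -- of its vertices, and a block with edges on both sides of its boundary gives a separator of
    -- L(G).
    Good : Fin n → Set
    Good r = (∀ u → ℓ u ≡ r → degree G u ≤ boundary r) ⊎ m ≤ boundary r

    private
      d≤boundary : ∀ {r} → Good r → ∀ u → ℓ u ≡ r → d ≤ boundary r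
      d≤boundary (inj₁ deg) u eq = ≤-trans (min-degree u) (deg u eq)
      d≤boundary (inj₂ m≤)  _ _  = ≤-trans (d≤m (≤-<-trans z≤n c<k) d²≤[2+m]c) m≤

      -- If both bounds come from degrees, this is the degree sum of `uv`. Otherwise one boundary
      -- has at least `m` edges, and the other, having at least `d ≥ 2`, makes up for the 2.
      boundary-sum : ∀ {u v} → Good (ℓ u) → Good (ℓ v) → Adj G u v → 2 + m ≤ boundary (ℓ u) + boundary (ℓ v)
      boundary-sum (inj₁ p) (inj₁ q) uv = ≤-trans (degree-sum uv) (+-mono-≤ (p _ refl) (q _ refl))
      boundary-sum {v = v} (inj₂ m≤) good _ =
        ≤-trans (≤-reflexive (+-comm 2 m)) (+-mono-≤ m≤ (≤-trans 2≤d (d≤boundary good v refl)))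
      boundary-sum {u} good (inj₂ m≤) _ = +-mono-≤ (≤-trans 2≤d (d≤boundary good u refl)) m≤

    -- An edge inside the block and one outside it have no common end, so in L(G) the boundary edges
    -- separate the two kinds.
    shared-boundary : ∀ {r e f} → Inside r e → Outside r f → m ≤ boundary r
    shared-boundary {r} {e} {f} (e₁ , e₂) (f₁ , f₂) = begin
      m                                    ≤⟨ separator {Inside r} S (λ {e} {f} → closed {e} {f}) e∉S (e₁ , e₂) f∉S (f₁ ∘ proj₁) ⟩
      length S                             ≡⟨ length-filter-∑ cut? allEdges ⟩
      ∑ allEdges (𝟙 ∘ cut?)                ≤⟨ ∑-mono allEdges split ⟩
      ∑ allEdges (λ e → 𝟙 (leaves? r (src e) (tgt e)) + 𝟙 (leaves? r (tgt e) (src e)))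
                                           ≡⟨ handshake (λ u v → 𝟙 (leaves? r u v)) ⟨
      boundary r                           ∎
      where
      open ≤-Reasoning
      cut? : ∀ e → Dec (Leaves r (src e) (tgt e) ⊎ Leaves r (tgt e) (src e))
      cut? e = leaves? r (src e) (tgt e) ⊎-dec leaves? r (tgt e) (src e)
      S = filter cut? allEdges
      ∈S : ∀ {e} → e ∈ S → Leaves r (src e) (tgt e) ⊎ Leaves r (tgt e) (src e)
      ∈S e∈ = proj₂ (∈-filter⁻ cut? {xs = allEdges} e∈)
      e∉S : e ∉ S
      e∉S e∈ = [ (λ p → proj₂ p e₂) , (λ p → proj₂ p e₁) ]′ (∈S e∈)
      f∉S : f ∉ S
      f∉S f∈ = [ (λ p → f₁ (proj₁ p)) , (λ p → f₂ (proj₁ p)) ]′ (∈S f∈)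
      closed : ∀ {e f} → Inside r e → LineAdj G e f → f ∉ S → Inside r f
      closed {e} {f} (e₁ , e₂) ef f∉ = at (lineAdj⁻ {e} {f} ef)
        where
        stays : ∀ {u v} → ℓ u ≡ r → ¬ Leaves r u v → ℓ v ≡ r
        stays {u} {v} p ¬leaves = decidable-stable (ℓ v ≟ r) λ q → ¬leaves (p , q)
        in-r : ∀ {x} → Incident x e → ℓ x ≡ r
        in-r (inj₁ refl) = e₁
        in-r (inj₂ refl) = e₂
        at : (∃ λ x → Incident x e × Incident x f) → Inside r f
        at (_ , x∈e , inj₁ refl) = in-r x∈e , stays (in-r x∈e) (f∉ ∘ ∈-filter⁺ cut? (∈-allEdges f) ∘ inj₁)
        at (_ , x∈e , inj₂ refl) = stays (in-r x∈e) (f∉ ∘ ∈-filter⁺ cut? (∈-allEdges f) ∘ inj₂) , in-r x∈e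
      split : ∀ e → 𝟙 (cut? e) ≤ 𝟙 (leaves? r (src e) (tgt e)) + 𝟙 (leaves? r (tgt e) (src e))
      split e with leaves? r (src e) (tgt e) | leaves? r (tgt e) (src e)
      ... | yes _ | _     = s≤s z≤n
      ... | no _  | yes _ = s≤s z≤n
      ... | no _  | no _  = z≤n

    -- Double counting of the shares, scaled by d². Every block receives at least `k * (d * d)` by
    -- `g-mass`; a crossing edge gives at most `d * d` to its two blocks by `g-shares`, and any
    -- other edge gives nothing.
    good⇒crossing : (∀ u → Good (ℓ u)) → k * components ℓ ≤ crossing
    good⇒crossing good = *-cancelʳ-≤ (k * components ℓ) crossing (d * d) ⦃ >-nonZero 0<d² ⦄ (begin
      k * components ℓ * (d * d)                   ≡⟨ regroup k (components ℓ) (d * d) ⟩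
      components ℓ * (k * (d * d))                 ≡⟨ ∑-*ʳ (allFin n) (k * (d * d)) (λ r → 𝟙 (ℓ r ≟ r)) ⟨
      ∑ⱽ (λ r → 𝟙 (ℓ r ≟ r) * (k * (d * d)))       ≤⟨ ∑-mono (allFin n) mass ⟩
      ∑ⱽ (λ r → boundary r * G' r)                 ≡⟨ ∑-cong (allFin n) (λ r → distribute r) ⟩
      ∑ⱽ (λ r → ∑ⱽ (λ u → ∑ⱽ (λ v → a u v * (l r u v * G' r))))
        ≡⟨ ∑-swap (allFin n) (allFin n) _ ⟩
      ∑ⱽ (λ u → ∑ⱽ (λ r → ∑ⱽ (λ v → a u v * (l r u v * G' r))))
        ≡⟨ ∑-cong (allFin n) (λ u → trans (∑-swap (allFin n) (allFin n) _)
             (∑-cong (allFin n) (λ v → ∑-*ˡ (allFin n) (a u v) (λ r → l r u v * G' r)))) ⟩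
      ∑ⱽ (λ u → ∑ⱽ (λ v → a u v * share u v))      ≡⟨ handshake share ⟩
      ∑ allEdges (λ e → share (src e) (tgt e) + share (tgt e) (src e))
                                                   ≤⟨ ∑-mono allEdges edge-shares ⟩
      ∑ allEdges (λ e → 𝟙 (crosses? e) * (d * d))  ≡⟨ ∑-*ʳ allEdges (d * d) (𝟙 ∘ crosses?) ⟩
      crossing * (d * d)                           ∎)
      where
      open ≤-Reasoning
      0<d² : 0 < d * d
      0<d² = *-mono-≤ (≤-trans (s≤s z≤n) 2≤d) (≤-trans (s≤s z≤n) 2≤d)
      regroup : ∀ x y z → x * y * z ≡ y * (x * z)
      regroup = solve-∀
      a : Fin n → Fin n → ℕ
      a u v = 𝟙 (adj? u v)
      l : Fin n → Fin n → Fin n → ℕ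
      l r u v = 𝟙 (leaves? r u v)
      G' : Fin n → ℕ
      G' r = g (boundary r)
      share : Fin n → Fin n → ℕ
      share u v = ∑ⱽ (λ r → l r u v * G' r)
      mass : ∀ r → 𝟙 (ℓ r ≟ r) * (k * (d * d)) ≤ boundary r * G' r
      mass r with ℓ r ≟ r
      ... | no _   = z≤n
      ... | yes eq = ≤-trans (≤-reflexive (+-identityʳ _)) (g-mass (d≤boundary (subst Good eq (good r)) r eq))
      distribute : ∀ r → boundary r * G' r ≡ ∑ⱽ (λ u → ∑ⱽ (λ v → a u v * (l r u v * G' r)))
      distribute r = trans (sym (∑-*ʳ (allFin n) (G' r) _)) (∑-cong (allFin n) λ u →
        trans (sym (∑-*ʳ (allFin n) (G' r) _)) (∑-cong (allFin n) λ v → *-assoc (a u v) (l r u v) (G' r)))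
      share-value : ∀ u v → share u v ≡ l (ℓ u) u v * G' (ℓ u)
      share-value u v = ∑-single (λ r → l r u v * G' r) (Unique.allFin⁺ n) (∈-allFin (ℓ u))
        (λ r r≢ → cong (_* G' r) (𝟙-no (leaves? r u v) λ p → r≢ (sym (proj₁ p))))
      share-same : ∀ {u v} → ℓ u ≡ ℓ v → share u v ≡ 0
      share-same {u} {v} eq = trans (share-value u v)
        (cong (_* G' (ℓ u)) (𝟙-no (leaves? (ℓ u) u v) λ p → proj₂ p (sym eq)))
      share-cross : ∀ {u v} → ℓ u ≢ ℓ v → share u v ≡ G' (ℓ u)
      share-cross {u} {v} neq = trans (share-value u v)
        (trans (cong (_* G' (ℓ u)) (𝟙-yes (leaves? (ℓ u) u v) (refl , neq ∘ sym))) (+-identityʳ _))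
      edge-shares : ∀ e → share (src e) (tgt e) + share (tgt e) (src e) ≤ 𝟙 (crosses? e) * (d * d)
      edge-shares e@((s , t) , _ , st) with ℓ s ≟ ℓ t
      ... | yes eq = ≤-reflexive (cong₂ _+_ (share-same eq) (share-same (sym eq)))
      ... | no neq = begin
        share s t + share t s  ≡⟨ cong₂ _+_ (share-cross neq) (share-cross (neq ∘ sym)) ⟩
        G' (ℓ s) + G' (ℓ t)    ≤⟨ g-shares (d≤boundary (good s) s refl) (d≤boundary (good t) t refl)
                                    (≤-trans d²≤[2+m]c (*-monoˡ-≤ c (boundary-sum (good s) (good t) st))) ⟩
        d * d                  ≡⟨ +-identityʳ _ ⟨
        d * d + 0              ∎

    -- All edges at vertices outside the block cross, and no edge is counted twice.
    independent-complement⇒crossing : ∀ {r} → (∀ e → ¬ Outside r e) → d * components ℓ ≤ crossing + d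
    independent-complement⇒crossing {r} none = begin
      d * components ℓ                            ≡⟨ ∑-*ˡ (allFin n) d (λ u → 𝟙 (ℓ u ≟ u)) ⟨
      ∑ⱽ (λ u → d * 𝟙 (ℓ u ≟ u))                  ≤⟨ ∑-mono (allFin n) representative ⟩
      ∑ⱽ (λ u → ∑ⱽ (λ v → 𝟙 (adj? u v) * off u) + d * 𝟙 (u ≟ r))
                                                  ≡⟨ ∑-+ (allFin n) (λ u → ∑ⱽ (λ v → 𝟙 (adj? u v) * off u)) _ ⟩
      ∑ⱽ (λ u → ∑ⱽ (λ v → 𝟙 (adj? u v) * off u)) + ∑ⱽ (λ u → d * 𝟙 (u ≟ r))
                                                  ≡⟨ cong₂ _+_ (handshake (λ u _ → off u)) only-r ⟩
      ∑ allEdges (λ e → off (src e) + off (tgt e)) + d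
                                                  ≤⟨ +-monoˡ-≤ d (∑-mono allEdges one-end) ⟩
      crossing + d                                ∎
      where
      open ≤-Reasoning
      off : Fin n → ℕ
      off u = 𝟙 (¬? (ℓ u ≟ r))
      only-r : ∑ⱽ (λ u → d * 𝟙 (u ≟ r)) ≡ d
      only-r = trans (∑-single (λ u → d * 𝟙 (u ≟ r)) (Unique.allFin⁺ n) (∈-allFin r)
                       (λ u u≢r → trans (cong (d *_) (𝟙-no (u ≟ r) u≢r)) (*-zeroʳ d)))
                     (trans (cong (d *_) (𝟙-yes (r ≟ r) refl)) (*-identityʳ d))
      representative : ∀ u → d * 𝟙 (ℓ u ≟ u) ≤ ∑ⱽ (λ v → 𝟙 (adj? u v) * off u) + d * 𝟙 (u ≟ r)
      representative u with ℓ u ≟ u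
      ... | no _ = ≤-trans (≤-reflexive (*-zeroʳ d)) z≤n
      ... | yes ℓu≡u with u ≟ r
      ...   | yes _ = m≤n+m (d * 1) _
      ...   | no u≢r = begin
        d * 1                                  ≤⟨ *-mono-≤ (min-degree u) (≤-reflexive (sym (𝟙-yes (¬? (ℓ u ≟ r)) (u≢r ∘ trans (sym ℓu≡u))))) ⟩
        degree G u * off u                     ≡⟨ cong (_* off u) (degree-∑ u) ⟩
        ∑ⱽ (λ v → 𝟙 (adj? u v)) * off u        ≡⟨ ∑-*ʳ (allFin n) (off u) _ ⟨
        ∑ⱽ (λ v → 𝟙 (adj? u v) * off u)        ≤⟨ m≤m+n _ _ ⟩
        ∑ⱽ (λ v → 𝟙 (adj? u v) * off u) + d * 0 ∎
      one-end : ∀ e → off (src e) + off (tgt e) ≤ 𝟙 (crosses? e)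
      one-end e with ℓ (src e) ≟ r | ℓ (tgt e) ≟ r
      ... | yes _ | yes _ = z≤n
      ... | no p  | no q  = contradiction (p , q) (none e)
      ... | yes p | no q  = ≤-reflexive (sym (𝟙-yes (crosses? e) λ eq → q (trans (sym eq) p)))
      ... | no p  | yes q = ≤-reflexive (sym (𝟙-yes (crosses? e) λ eq → p (trans eq q)))

    -- The Nash-Williams and Tutte condition, written without subtraction. A block fails to be good
    -- only if it contains an edge while its complement contains none; then d(p - 1) crossing edges
    -- suffice because k ≤ d.
    crossing-bound : k * components ℓ ≤ crossing + k
    crossing-bound with F.any? (λ u → any? (inside? (ℓ u)) allEdges ×-dec ¬? (any? (outside? (ℓ u)) allEdges))
    ... | yes (u , _ , none) = weaken (components ℓ)
        (independent-complement⇒crossing (λ e out → none (lose (∈-allEdges e) out)))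
      where
      weaken : ∀ p → d * p ≤ crossing + d → k * p ≤ crossing + k
      weaken zero    _  = ≤-trans (≤-reflexive (*-zeroʳ k)) z≤n
      weaken (suc p) le = begin
        k * suc p      ≡⟨ trans (*-suc k p) (+-comm k _) ⟩
        k * p + k      ≤⟨ +-monoˡ-≤ k (*-monoˡ-≤ p (≤-trans (m≤n+m k c) (≤-reflexive c+k≡d))) ⟩
        d * p + k      ≤⟨ +-monoˡ-≤ k (+-cancelʳ-≤ d (d * p) crossing
                            (≤-trans (≤-reflexive (trans (+-comm _ d) (sym (*-suc d p)))) le)) ⟩
        crossing + k   ∎
        where open ≤-Reasoning
    ... | no none = ≤-trans (good⇒crossing good) (m≤m+n _ _)
      where
      good : ∀ u → Good (ℓ u)
      good u with any? (inside? (ℓ u)) allEdges | any? (outside? (ℓ u)) allEdges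
      ... | no ¬in  | _       = inj₁ (edgeless⇒degree≤boundary λ e i → ¬in (lose (∈-allEdges e) i))
      ... | yes ins | no ¬out = contradiction (u , ins , ¬out) none
      ... | yes ins | yes out =
        let e , _ , i = find ins ; f , _ , o = find out in inj₂ (shared-boundary {e = e} {f} i o)

    -- Singletons contain no edge, so all blocks are good and the summand `k` on the right is saved.
    discrete-bound : (∀ u → ℓ u ≡ u) → k * components ℓ ≤ crossing
    discrete-bound discrete = good⇒crossing λ u → inj₁ (edgeless⇒degree≤boundary λ e (p , q) →
      src≢tgt e (trans (sym (discrete (src e))) (trans (trans p (sym q)) (discrete (tgt e)))))

theorem14 : (k : ℕ) → 2 ≤ k → (n : ℕ) (G : Graph n) (d : ℕ) →
    MinDegree G d → SuperEdgeConnected G → k < d → d < 2 * k →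
    MConnected (LineAdj G) (ceilDiv (d * d) (d ∸ k) ∸ 2) →
    HasCISTs (LineAdj G) k
theorem14 k 2≤k n G d (min-degree , v₀ , _) _ k<d d<2k m-connected =
  Packing.packing⇒CISTs n≡1+r v₀ G (F.fromℕ< (≤-trans (s≤s z≤n) 2≤k)) enough cuts
  where
  open LineGraph G
  open Counting G
  open import Data.List.Membership.DecPropositional _≟ᴱ_ using (_∈?_)
  open ≤-Reasoning

  c = d ∸ k
  m = ceilDiv (d * d) c ∸ 2

  nonempty : ∀ {n} → Fin n → ∃ λ r → n ≡ suc r
  nonempty {suc r} _ = r , refl

  r = proj₁ (nonempty v₀)
  n≡1+r = proj₂ (nonempty v₀)

  c+k≡d : c + k ≡ d
  c+k≡d = m∸n+n≡m (<⇒≤ k<d)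

  c<k : c < k
  c<k = +-cancelʳ-< k c k (begin-strict
    c + k  ≡⟨ c+k≡d ⟩
    d      <⟨ d<2k ⟩
    2 * k  ≡⟨ cong (k +_) (+-identityʳ k) ⟩
    k + k  ∎)

  d²≤[2+m]c : d * d ≤ (2 + m) * c
  d²≤[2+m]c = begin
    d * d                    ≤⟨ ≤-ceilDiv* (d * d) c (m<n⇒0<n∸m k<d) ⟩
    -- Truncation in `m` is harmless: x ≤ 2 + (x ∸ 2) holds for every x.
    ceilDiv (d * d) c * c    ≤⟨ *-monoˡ-≤ c (m≤n+m∸n (ceilDiv (d * d) c) 2) ⟩
    (2 + m) * c              ∎

  module Cut = Bound c+k≡d c<k (≤-trans 2≤k (<⇒≤ k<d)) d²≤[2+m]c min-degree m-connected

  enough : k * n ≤ length allEdges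
  enough = begin
    -- `label []` is the identity and `rank []` is 0, so this equation says that the discrete
    -- partition has `n` blocks.
    k * n                    ≡⟨ cong (k *_) (rank+components []) ⟨
    k * components (λ v → v) ≤⟨ Cut.discrete-bound (λ v → v) (λ _ → refl) ⟩
    Blocks.crossing (λ v → v) ≡⟨ length-filter-∑ (Blocks.crosses? (λ v → v)) allEdges ⟨
    length (filter (Blocks.crosses? (λ v → v)) allEdges) ≤⟨ length-filter (Blocks.crosses? (λ v → v)) allEdges ⟩
    length allEdges          ∎

  -- For the partition into the components of `R`, the number of blocks is `n` minus the rank of
  -- `R`, and every crossing edge lies outside `R`. This turns Edmonds' condition into the partition
  -- bound.
  cuts : ∀ R → k * r ≤ ∑ allEdges (λ e → 𝟙 (¬? (e ∈? R))) + k * rank R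
  cuts R = +-cancelʳ-≤ k (k * r) _ (begin
    k * r + k                                        ≡⟨ trans (+-comm (k * r) k) (sym (*-suc k r)) ⟩
    k * suc r                                        ≡⟨ cong (k *_) (trans (sym n≡1+r) (sym (rank+components R))) ⟩
    k * (rank R + components (label R))              ≡⟨ *-distribˡ-+ k (rank R) _ ⟩
    k * rank R + k * components (label R)            ≤⟨ +-monoʳ-≤ (k * rank R) (Cut.crossing-bound (label R)) ⟩
    k * rank R + (Blocks.crossing (label R) + k)     ≡⟨ rearrange (k * rank R) (Blocks.crossing (label R)) k ⟩
    Blocks.crossing (label R) + k * rank R + k       ≤⟨ +-monoˡ-≤ k (+-monoˡ-≤ (k * rank R) (∑-mono allEdges λ e →
                                                          𝟙-mono (Blocks.crosses? (label R) e) (¬? (e ∈? R)) (_∘ label-respects R))) ⟩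
    ∑ allEdges (λ e → 𝟙 (¬? (e ∈? R))) + k * rank R + k ∎)
    where
    rearrange : ∀ x y z → x + (y + z) ≡ y + x + z
    rearrange = solve-∀
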